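{- There exist a finite alphabet $\Omega$ and a language $L_0 \subseteq \Omega^*$ defined by a categorial grammar with unique category assignment, such that for every finite alphabet $\Sigma$ and every context-free language $L \subseteq \Sigma^+$ there exists a homomorphism $h \colon \Sigma \to \Omega^+$ (extended to strings by $h(a_1 \ldots a_n)=h(a_1)\ldots h(a_n)$), such that for every string $w \in \Sigma^+$, $w$ is in $L$ if and only if $h(w)$ is in $L_0$.
   Context: All languages are assumed to be without the empty string: $\Sigma^+$ is the set of non-empty strings over $\Sigma$. Let $\mathrm{BC}$ be a finite set of primitive categories. The set of categories is defined inductively: every primitive category is a category; if $A$ and $B$ are categories, then so are $(B \backslash A)$ and $(A / B)$. Strings of categories are written with semicolons between individual categories. A categorial grammar is a quadruple $(\Sigma, \mathrm{BC}, \triangleright, S)$, where $\Sigma$ is a finite alphabet, $\mathrm{BC}$ is a finite set of primitive categories, $\triangleright$ is a finite relation of category assignments of the form $a \triangleright A$ with $a \in \Sigma$ and $A$ a category, and $S$ is a category (not necessarily primitive) designated as the target category. A string of categories $\alpha$ is reducible in one step to a string of categories $\beta$ if $\alpha=\eta; A/B; B; \theta$ or $\alpha=\eta; B; B \backslash A; \theta$, while $\beta=\eta; A; \theta$, for some categories $A, B$ and some (possibly empty) strings of categories $\eta,\theta$. A string $\alpha$ is reducible to $\beta$ if it can be transformed to $\beta$ by zero or more such steps. The language defined by $G=(\Sigma, \mathrm{BC}, \triangleright, S)$ is the set $L(G)$ of all strings $a_1 \ldots a_n$ ($n \geqslant 1$, $a_i \in \Sigma$) for which there exists a string of categories $A_1;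 \ldots; A_n$ with $a_i \triangleright A_i$ for all $i$ that is reducible to $S$. A categorial grammar is with unique category assignment if for every symbol $a$ of its alphabet there is a unique category $A$ with $a \triangleright A$. -}

module Defs where

open import Level using (0ℓ)
open import Data.Fin.Base using (Fin)
open import Data.List.Base using (List; []; _∷_; [_]; _++_; map; concatMap)
open import Data.List.NonEmpty.Base using (List⁺; toList)
open import Data.List.Membership.Propositional using () renaming (_∈_ to _∈ˡ_)
open import Data.List.Relation.Binary.Pointwise.Base using (Pointwise)
open import Data.Product using (_×_; _,_; ∃-syntax; ∃!)
open import Data.Sum.Base using (_⊎_; inj₁; inj₂)
open import Function.Base using (_∘_)
open import Function.Bundles using (_↔_)
open import Relation.Binary.Construct.Closure.ReflexiveTransitive using (Star)
open import Relation.Binary.PropositionalEquality using (_≡_; _≢_)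
open import Relation.Unary using (Pred; _≐_)

Finite : Set → Set
Finite A = ∃[ n ] (A ↔ Fin n)

-- Σ* is List A; Σ⁺ is its subset of non-empty lists.
Language : Set → Set₁
Language A = Pred (List A) 0ℓ

NonEmpty : {A : Set} → Language A
NonEmpty w = w ≢ []

homomorphism : {A B : Set} → (A → List⁺ B) → List A → List B
homomorphism h = concatMap (toList ∘ h)

-- Arbitrary context-free rules are allowed, including ε-rules and unit rules.
record ContextFreeGrammar (A : Set) : Set₁ where
  field
    N        : Set
    N-finite : Finite N
    rules    : List (N × List (N ⊎ A))
    start    : N

  infix 4 _⇒_

  data _⇒_ : List (N ⊎ A) → List (N ⊎ A) → Set where
    rewrite-with : ∀ {X α} → (X , α) ∈ˡ rules → ∀ η θ →
                   η ++ inj₁ X ∷ θ ⇒ η ++ α ++ θ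

  language : Language A
  language w = Star _⇒_ [ inj₁ start ] (map inj₂ w)

ContextFree : {A : Set} → Language A → Set₁
ContextFree {A} L = ∃[ G ] (L ≐ ContextFreeGrammar.language {A} G)

infix 7 _/_ _⧵_

data Category (BC : Set) : Set where
  prim : BC → Category BC
  _⧵_  : Category BC → Category BC → Category BC
  _/_  : Category BC → Category BC → Category BC

infix 4 _⟶_

data _⟶_ {BC : Set} : List (Category BC) → List (Category BC) → Set where
  reduce-/ : ∀ A B η θ → η ++ (A / B) ∷ B ∷ θ ⟶ η ++ A ∷ θ
  reduce-⧵ : ∀ A B η θ → η ++ B ∷ (B ⧵ A) ∷ θ ⟶ η ++ A ∷ θ

Reducible : {BC : Set} → List (Category BC) → List (Category BC) → Set
Reducible = Star _⟶_

-- The finite relation ▷ is given by the list of its pairs.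
record CategorialGrammar (A : Set) : Set₁ where
  field
    BC          : Set
    BC-finite   : Finite BC
    assignments : List (A × Category BC)
    target      : Category BC

  infix 4 _▷_

  _▷_ : A → Category BC → Set
  a ▷ C = (a , C) ∈ˡ assignments

  language : Language A
  language w = NonEmpty w × ∃[ α ] (Pointwise _▷_ w α × Reducible α [ target ])

  UniqueCategoryAssignment : Set
  UniqueCategoryAssignment = ∀ a → ∃! _≡_ (λ C → a ▷ C)

{-# OPTIONS --safe #-}

-- The image of a word describes all runs of a nondeterministic stack of counters.  For each symbol, the
-- stack machine pushes a counter with one of several initial values, then pops counters that must hold
-- prescribed values and subtracts a constant from the next one.  A counter n is pushed by n letters 𝐨,
-- and each of them must find its own matching letter 𝐜; hence values are compared exactly.  Everything
-- that a run does not use has to disappear.  Operations that pop can be skipped because their letters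
-- have categories X ⧵ X and the like, forming a finite automaton, although these same letters serve as
-- arguments of 𝐨 when they are used.  An operation that pushes is skipped by matching its letters 𝐨
-- with as many 𝐜 written right after them; when it is used, these 𝐜 are skipped in their turn.  The
-- letters #₁ and #₂ make sure that exactly one operation is used from each list of alternatives.
--
-- Such a machine can pop several counters at once, but it cannot push depending on what it has popped.
-- This suffices for grammars with the rules A → a and A → a B₁ … Bₖ b: on reading a, guess A and the rule
-- and push a number encoding both; on reading b, pop the numbers of Bₖ, …, B₁ and subtract the number
-- of the rule, so that the number of A remains.  To obtain such rules from a Chomsky normal form, follow
-- the leftmost branch of a tree to its first symbol and its rightmost branch to the last one: what lies
-- between them are the subtrees hanging off these branches, and a sequence of subtrees hanging off a
-- branch has a first tree and a last tree, which are decomposed in the same way.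
module Submission where

open import Defs
open import Data.Empty using (⊥; ⊥-elim)
open import Data.Fin.Base using (Fin; zero; suc; toℕ)
open import Data.Fin.Properties using (*↔×; all?; any?; toℕ-injective; toℕ<n) renaming (_≟_ to _≟ᶠ_)
open import Data.List.Base
  using (List; []; _∷_; [_]; _++_; _∷ʳ_; _∷ʳ′_; allFin; cartesianProduct; catMaybes; concatMap; filter;
         foldr; initLast; length; lookup; map)
import Data.List.Membership.DecPropositional as DecMembership
open import Data.List.Membership.Propositional using (find) renaming (_∈_ to _∈ˡ_)
open import Data.List.Membership.Propositional.Properties
  using (∈-++⁺ˡ; ∈-++⁺ʳ; ∈-++⁻; ∈-allFin; ∈-cartesianProduct⁺; ∈-concatMap⁺; ∈-concatMap⁻; ∈-filter⁺;
         ∈-filter⁻; ∈-map⁺; ∈-map⁻; ∈-∃++)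
open import Data.List.NonEmpty.Base using (List⁺; _∷_)
import Data.List.Properties as List
open import Data.List.Properties using (++-assoc; ++-identityʳ; foldr-++; map-++; ∷-injectiveʳ)
open import Data.List.Relation.Binary.Pointwise.Base using (Pointwise; []; _∷_)
open import Data.List.Relation.Unary.All as All using (All; []; _∷_)
open import Data.List.Relation.Unary.All.Properties using (++⁻ˡ; ++⁻ʳ)
open import Data.List.Relation.Unary.Any as Any using (here; there)
open import Data.List.Relation.Unary.Any.Properties using (lookup-index)
open import Data.Maybe.Base using (Maybe; just; nothing)
import Data.Maybe.Properties as Maybe
open import Data.Nat.Base using (ℕ; zero; suc; _+_; _*_; _∸_; _≤_; _<_; z≤n; s≤s)
open import Data.Nat.Properties hiding (_≟_)
import Data.Nat.Properties as ℕ
open import Data.Product using (_×_; _,_; ∃-syntax; Σ-syntax; proj₁; proj₂; uncurry)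
open import Data.Product.Function.NonDependent.Propositional using (_×-↔_)
import Data.Product.Properties as Product
open import Data.Sum.Base using (_⊎_; inj₁; inj₂)
import Data.Sum.Properties as Sum
open import Data.Unit.Base using (⊤; tt)
open import Function.Base using (_∘_; id)
open import Function.Bundles using (_⇔_; Inverse; mk⇔; mk↔ₛ′)
open import Function.Construct.Composition using (_↔-∘_; _⇔-∘_)
open import Function.Construct.Identity using (↔-id)
open import Function.Construct.Symmetry using (↔-sym; ⇔-sym)
open import Relation.Binary.Construct.Closure.ReflexiveTransitive using (Star; ε; _◅_; _◅◅_; gmap)
open import Relation.Binary.Definitions using (DecidableEquality; tri<; tri≈; tri>)
open import Relation.Binary.PropositionalEquality using (_≡_; _≢_; refl; sym; trans; cong; subst; subst₂)
open import Relation.Nullary.Decidable using (Dec; yes; no; True; toWitness; map′; _×-dec_; _⊎-dec_)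
open import Relation.Unary using (_∈_; _⊆_; _≐_)

finite-listed : ∀ {A : Set} (xs : List A) (complete : ∀ a → a ∈ˡ xs)
                {distinct : True (all? λ i → Any.index (complete (lookup xs i)) ≟ᶠ i)} → Finite A
finite-listed xs complete {distinct} =
  length xs ,
  mk↔ₛ′ (Any.index ∘ complete) (lookup xs) (toWitness distinct) (λ a → sym (lookup-index (complete a)))

-- The universal categorial grammar

data Prim : Set where
  𝐓 𝐘 𝐗 : Prim

data Letter : Set where
  𝐚 𝐛 𝐜 𝐞 𝐟 𝐨 𝐪 𝐰 𝐱 𝐲 𝐳 #₁ #₂ : Letter

Cat : Set
Cat = Category Prim

T Y X X₂ R Q C F W E B : Cat
T  = prim 𝐓
Y  = prim 𝐘
X  = prim 𝐗
X₂ = (Y / X) ⧵ T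
R  = T ⧵ T
Q  = Y ⧵ T
C  = X ⧵ X
F  = X ⧵ X₂
W  = X₂ ⧵ X
E  = X / C
B  = (R / Q) / X

category : Letter → Cat
category 𝐚  = (R / F) / Y
category 𝐛  = B
category 𝐜  = C
category 𝐞  = E
category 𝐟  = F
category 𝐨  = (Y / C) / Y
category 𝐪  = Q
category 𝐰  = W
category 𝐱  = X
category 𝐲  = Y / X
category 𝐳  = (Q / F) / Y
category #₁ = ((((T ⧵ Y) / W) / F) / (R / F)) / T
category #₂ = (((T ⧵ Y) / E) / B) / T

letters : List Letter
letters = 𝐚 ∷ 𝐛 ∷ 𝐜 ∷ 𝐞 ∷ 𝐟 ∷ 𝐨 ∷ 𝐪 ∷ 𝐰 ∷ 𝐱 ∷ 𝐲 ∷ 𝐳 ∷ #₁ ∷ #₂ ∷ []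

-- What the categories derive, for the part of the first string before its suffix, the second string:
-- Idle is T, Junk is R, Stop is Q, Busy is Y and Body is X.  After a counter has been pushed, Idle
-- spans the time until #₁ or #₂, and Busy ends inside a popping operation.
mutual
  data Idle : List Letter → List Letter → Set where
    _∙_   : ∀ {s s₁ s₂} → Idle s s₁ → Junk s₁ s₂ → Idle s s₂
    stop  : ∀ {s s₁ s₂} → Busy s s₁ → Stop s₁ s₂ → Idle s s₂
    base  : ∀ {s s₁} → Body s (𝐟 ∷ s₁) → Idle (𝐲 ∷ s) s₁

  data Junk : List Letter → List Letter → Set where
    push  : ∀ {s s₁} → Busy s (𝐟 ∷ s₁) → Junk (𝐚 ∷ s) s₁
    pop   : ∀ {s s₁ s₂} → Body s s₁ → Stop s₁ s₂ → Junk (𝐛 ∷ s) s₂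

  data Stop : List Letter → List Letter → Set where
    here  : ∀ {s} → Stop (𝐪 ∷ s) s
    root  : ∀ {s s₁} → Busy s (𝐟 ∷ s₁) → Stop (𝐳 ∷ s) s₁

  data Busy : List Letter → List Letter → Set where
    base  : ∀ {s s₁} → Body s s₁ → Busy (𝐲 ∷ s) s₁
    unit  : ∀ {s s₁} → Busy s (𝐜 ∷ s₁) → Busy (𝐨 ∷ s) s₁
    next  : ∀ {s s₁ s₂ s₃} → Idle s (#₁ ∷ s₁) → Idle s₁ (𝐚 ∷ s₂) →
            Busy s₂ (𝐟 ∷ 𝐰 ∷ s₃) → Busy s s₃
    first : ∀ {s s₁ s₂} → Idle s (#₂ ∷ s₁) → Idle s₁ (𝐛 ∷ 𝐞 ∷ s₂) → Busy s s₂

  data Body : List Letter → List Letter → Set where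
    x-    : ∀ {s} → Body (𝐱 ∷ s) s
    e-    : ∀ {s} → Body (𝐞 ∷ 𝐜 ∷ s) s
    _-c   : ∀ {s s₁} → Body s (𝐜 ∷ s₁) → Body s s₁
    _-fw  : ∀ {s s₁} → Body s (𝐟 ∷ 𝐰 ∷ s₁) → Body s s₁

-- All partial applications of the letters; this family is closed under both reductions.
data Span : Cat → List Letter → List Letter → Set where
  idle   : ∀ {s s₁} → Idle s s₁ → Span T s s₁
  busy   : ∀ {s s₁} → Busy s s₁ → Span Y s s₁
  body   : ∀ {s s₁} → Body s s₁ → Span X s s₁
  body₂  : ∀ {s s₁} → Body s (𝐟 ∷ s₁) → Span X₂ s s₁
  junk   : ∀ {s s₁} → Junk s s₁ → Span R s s₁
  stop   : ∀ {s s₁} → Stop s s₁ → Span Q s s₁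
  ⟨a⟩    : ∀ {s} → Span ((R / F) / Y) (𝐚 ∷ s) s
  ⟨b⟩    : ∀ {s} → Span B (𝐛 ∷ s) s
  ⟨c⟩    : ∀ {s} → Span C (𝐜 ∷ s) s
  ⟨e⟩    : ∀ {s} → Span E (𝐞 ∷ s) s
  ⟨f⟩    : ∀ {s} → Span F (𝐟 ∷ s) s
  ⟨o⟩    : ∀ {s} → Span ((Y / C) / Y) (𝐨 ∷ s) s
  ⟨w⟩    : ∀ {s} → Span W (𝐰 ∷ s) s
  ⟨y⟩    : ∀ {s} → Span (Y / X) (𝐲 ∷ s) s
  ⟨z⟩    : ∀ {s} → Span ((Q / F) / Y) (𝐳 ∷ s) s
  ⟨#₁⟩   : ∀ {s} → Span (((((T ⧵ Y) / W) / F) / (R / F)) / T) (#₁ ∷ s) s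
  ⟨#₂⟩   : ∀ {s} → Span ((((T ⧵ Y) / E) / B) / T) (#₂ ∷ s) s
  ⟨aY⟩   : ∀ {s s₁} → Busy s s₁ → Span (R / F) (𝐚 ∷ s) s₁
  ⟨bX⟩   : ∀ {s s₁} → Body s s₁ → Span (R / Q) (𝐛 ∷ s) s₁
  ⟨oY⟩   : ∀ {s s₁} → Busy s s₁ → Span (Y / C) (𝐨 ∷ s) s₁
  ⟨zY⟩   : ∀ {s s₁} → Busy s s₁ → Span (Q / F) (𝐳 ∷ s) s₁
  ⟨#₁T⟩  : ∀ {s s₁} → Idle s s₁ → Span ((((T ⧵ Y) / W) / F) / (R / F)) (#₁ ∷ s) s₁
  ⟨#₁Ta⟩ : ∀ {s s₁ s₂} → Idle s (𝐚 ∷ s₁) → Busy s₁ s₂ → Span (((T ⧵ Y) / W) / F) (#₁ ∷ s) s₂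
  ⟨#₁Tf⟩ : ∀ {s s₁ s₂} → Idle s (𝐚 ∷ s₁) → Busy s₁ (𝐟 ∷ s₂) → Span ((T ⧵ Y) / W) (#₁ ∷ s) s₂
  ⟨#₂T⟩  : ∀ {s s₁} → Idle s s₁ → Span (((T ⧵ Y) / E) / B) (#₂ ∷ s) s₁
  ⟨#₂Tb⟩ : ∀ {s s₁} → Idle s (𝐛 ∷ s₁) → Span ((T ⧵ Y) / E) (#₂ ∷ s) s₁
  cross₁ : ∀ {s s₁ s₂} → Idle s (𝐚 ∷ s₁) → Busy s₁ (𝐟 ∷ 𝐰 ∷ s₂) → Span (T ⧵ Y) (#₁ ∷ s) s₂
  cross₂ : ∀ {s s₁} → Idle s (𝐛 ∷ 𝐞 ∷ s₁) → Span (T ⧵ Y) (#₂ ∷ s) s₁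

span-letter : ∀ ω {s} → Span (category ω) (ω ∷ s) s
span-letter 𝐚  = ⟨a⟩
span-letter 𝐛  = ⟨b⟩
span-letter 𝐜  = ⟨c⟩
span-letter 𝐞  = ⟨e⟩
span-letter 𝐟  = ⟨f⟩
span-letter 𝐨  = ⟨o⟩
span-letter 𝐪  = stop here
span-letter 𝐰  = ⟨w⟩
span-letter 𝐱  = body x-
span-letter 𝐲  = ⟨y⟩
span-letter 𝐳  = ⟨z⟩
span-letter #₁ = ⟨#₁⟩
span-letter #₂ = ⟨#₂⟩

span-/ : ∀ {A B s s₁ s₂} → Span (A / B) s s₁ → Span B s₁ s₂ → Span A s s₂
span-/ ⟨a⟩          (busy k)  = ⟨aY⟩ k
span-/ (⟨aY⟩ k)     ⟨f⟩       = junk (push k)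
span-/ ⟨b⟩          (body k)  = ⟨bX⟩ k
span-/ (⟨bX⟩ k)     (stop l)  = junk (pop k l)
span-/ ⟨e⟩          ⟨c⟩       = body e-
span-/ ⟨o⟩          (busy k)  = ⟨oY⟩ k
span-/ (⟨oY⟩ k)     ⟨c⟩       = busy (unit k)
span-/ ⟨y⟩          (body k)  = busy (base k)
span-/ ⟨z⟩          (busy k)  = ⟨zY⟩ k
span-/ (⟨zY⟩ k)     ⟨f⟩       = stop (root k)
span-/ ⟨#₁⟩         (idle k)  = ⟨#₁T⟩ k
-- `#₁` takes 𝐚 before it has got its 𝐟, and then demands 𝐟 and 𝐰 itself: a counter pushed this way
-- has to end at a level boundary.
span-/ (⟨#₁T⟩ k)    (⟨aY⟩ l)  = ⟨#₁Ta⟩ k l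
span-/ (⟨#₁Ta⟩ k l) ⟨f⟩       = ⟨#₁Tf⟩ k l
span-/ (⟨#₁Tf⟩ k l) ⟨w⟩       = cross₁ k l
span-/ ⟨#₂⟩         (idle k)  = ⟨#₂T⟩ k
span-/ (⟨#₂T⟩ k)    ⟨b⟩       = ⟨#₂Tb⟩ k
span-/ (⟨#₂Tb⟩ k)   ⟨e⟩       = cross₂ k

span-⧵ : ∀ {A B s s₁ s₂} → Span B s s₁ → Span (B ⧵ A) s₁ s₂ → Span A s s₂
span-⧵ (body k)  ⟨c⟩          = body (k -c)
span-⧵ (body k)  ⟨f⟩          = body₂ k
-- Here 𝐲 is an argument instead of a functor. This second reading of a base string skips it as a
-- whole.
span-⧵ ⟨y⟩       (body₂ k)    = idle (base k)
span-⧵ (body₂ k) ⟨w⟩          = body (k -fw)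
span-⧵ (idle k)  (junk l)     = idle (k ∙ l)
span-⧵ (busy k)  (stop l)     = idle (stop k l)
span-⧵ (idle k)  (cross₁ l m) = busy (next k l m)
span-⧵ (idle k)  (cross₂ l)   = busy (first k l)

-- The target is the category of 𝐳 with its `Y` but without its 𝐟. Hence the counter opened by the
-- first letter of the word must extend to the end of the word.
grammar : CategorialGrammar Letter
grammar = record
  { BC          = Prim
  ; BC-finite   = finite-listed (𝐓 ∷ 𝐘 ∷ 𝐗 ∷ [])
      λ { 𝐓 → here refl ; 𝐘 → there (here refl) ; 𝐗 → there (there (here refl)) }
  ; assignments = map (λ ω → ω , category ω) letters
  ; target      = Q / F
  }
open CategorialGrammar grammar using (_▷_)

letters-complete : ∀ ω → ω ∈ˡ letters
letters-complete 𝐚  = here refl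
letters-complete 𝐛  = there (here refl)
letters-complete 𝐜  = there (there (here refl))
letters-complete 𝐞  = there (there (there (here refl)))
letters-complete 𝐟  = there (there (there (there (here refl))))
letters-complete 𝐨  = there (there (there (there (there (here refl)))))
letters-complete 𝐪  = there (there (there (there (there (there (here refl))))))
letters-complete 𝐰  = there (there (there (there (there (there (there (here refl)))))))
letters-complete 𝐱  = there (there (there (there (there (there (there (there (here refl))))))))
letters-complete 𝐲  = there (there (there (there (there (there (there (there (there (here refl)))))))))
letters-complete 𝐳  = there (there (there (there (there (there (there (there (there (there (here refl))))))))))
letters-complete #₁ = there (there (there (there (there (there (there (there (there (there (there (here refl)))))))))))
letters-complete #₂ = there (there (there (there (there (there (there (there (there (there (there (there (here refl))))))))))))

finite-Letter : Finite Letter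
finite-Letter = finite-listed letters letters-complete

▷-category : ∀ ω → ω ▷ category ω
▷-category ω = ∈-map⁺ (λ ω′ → ω′ , category ω′) (letters-complete ω)

▷-unique : ∀ {ω A} → ω ▷ A → category ω ≡ A
▷-unique m with ∈-map⁻ (λ ω′ → ω′ , category ω′) m
... | _ , _ , refl = refl

unique-assignment : CategorialGrammar.UniqueCategoryAssignment grammar
unique-assignment ω = category ω , ▷-category ω , ▷-unique

data Spans : List Cat → List Letter → List Letter → Set where
  []  : ∀ {s} → Spans [] s s
  _∷_ : ∀ {A α s s₁ s₂} → Span A s s₁ → Spans α s₁ s₂ → Spans (A ∷ α) s s₂

spans-word : ∀ {w α} → Pointwise _▷_ w α → Spans α w []
spans-word []                     = []
spans-word (_∷_ {x = ω} ω▷A ps) =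
  subst (λ A → Span A _ _) (▷-unique ω▷A) (span-letter ω) ∷ spans-word ps

spans-step : ∀ {α β s s₁} → α ⟶ β → Spans α s s₁ → Spans β s s₁
spans-step (reduce-/ A B [] θ) (p ∷ q ∷ ps)      = span-/ p q ∷ ps
spans-step (reduce-/ A B (D ∷ η) θ) (p ∷ ps)     = p ∷ spans-step (reduce-/ A B η θ) ps
spans-step (reduce-⧵ A B [] θ) (p ∷ q ∷ ps)      = span-⧵ p q ∷ ps
spans-step (reduce-⧵ A B (D ∷ η) θ) (p ∷ ps)     = p ∷ spans-step (reduce-⧵ A B η θ) ps

spans-reduce : ∀ {α β s s₁} → Reducible α β → Spans α s s₁ → Spans β s s₁
spans-reduce ε        ps = ps
spans-reduce (r ◅ rs) ps = spans-reduce rs (spans-step r ps)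

language⇒busy : ∀ {w} → CategorialGrammar.language grammar w → ∃[ s ] (w ≡ 𝐳 ∷ s × Busy s [])
language⇒busy (_ , α , ps , red) with spans-reduce red (spans-word ps)
... | ⟨zY⟩ k ∷ [] = _ , refl , k

-- Reductions obtained from the inductive families

⟶-context : ∀ (η θ : List Cat) {α β} → α ⟶ β → η ++ α ++ θ ⟶ η ++ β ++ θ
⟶-context η θ (reduce-/ A B η′ θ′) =
  subst₂ _⟶_ (eq ((A / B) ∷ B ∷ θ′)) (eq (A ∷ θ′)) (reduce-/ A B (η ++ η′) (θ′ ++ θ))
  where
  eq : ∀ γ → (η ++ η′) ++ γ ++ θ ≡ η ++ (η′ ++ γ) ++ θ
  eq γ = trans (++-assoc η η′ (γ ++ θ)) (cong (η ++_) (sym (++-assoc η′ γ θ)))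
⟶-context η θ (reduce-⧵ A B η′ θ′) =
  subst₂ _⟶_ (eq (B ∷ (B ⧵ A) ∷ θ′)) (eq (A ∷ θ′)) (reduce-⧵ A B (η ++ η′) (θ′ ++ θ))
  where
  eq : ∀ γ → (η ++ η′) ++ γ ++ θ ≡ η ++ (η′ ++ γ) ++ θ
  eq γ = trans (++-assoc η η′ (γ ++ θ)) (cong (η ++_) (sym (++-assoc η′ γ θ)))

reducible-++ : ∀ {α β α′ β′ : List Cat} → Reducible α α′ → Reducible β β′ → Reducible (α ++ β) (α′ ++ β′)
reducible-++ {α} {β} {α′} {β′} r r′ =
  gmap (_++ β) (⟶-context [] β) r ◅◅
  gmap (α′ ++_) (λ {γ} {δ} st → subst₂ _⟶_ (id-r γ) (id-r δ) (⟶-context α′ [] st)) r′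
  where

  id-r : ∀ γ → α′ ++ γ ++ [] ≡ α′ ++ γ
  id-r γ = cong (α′ ++_) (++-identityʳ γ)

record Derives (A : Cat) (s s₁ : List Letter) : Set where
  constructor derives
  field
    prefix  : List Letter
    split   : s ≡ prefix ++ s₁
    reduces : Reducible (map category prefix) [ A ]

letter : ∀ ω {s} → Derives (category ω) (ω ∷ s) s
letter ω = derives [ ω ] refl ε

infixl 6 _·/_
infixl 6 _·⧵_

_·/_ : ∀ {A B s s₁ s₂} → Derives (A / B) s s₁ → Derives B s₁ s₂ → Derives A s s₂
_·/_ {A} {B} (derives u refl r) (derives v refl r′) =
  derives (u ++ v) (sym (++-assoc u v _))
    (subst (λ α → Reducible α [ A ]) (sym (map-++ category u v))
      (reducible-++ r r′ ◅◅ reduce-/ A B [] [] ◅ ε))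

_·⧵_ : ∀ {A B s s₁ s₂} → Derives B s s₁ → Derives (B ⧵ A) s₁ s₂ → Derives A s s₂
_·⧵_ {A} {B} (derives u refl r) (derives v refl r′) =
  derives (u ++ v) (sym (++-assoc u v _))
    (subst (λ α → Reducible α [ A ]) (sym (map-++ category u v))
      (reducible-++ r r′ ◅◅ reduce-⧵ A B [] [] ◅ ε))

mutual
  derives-idle : ∀ {s s₁} → Idle s s₁ → Derives T s s₁
  derives-idle (k ∙ l)    = derives-idle k ·⧵ derives-junk l
  derives-idle (stop k l) = derives-busy k ·⧵ derives-stop l
  derives-idle (base k)   = letter 𝐲 ·⧵ (derives-body k ·⧵ letter 𝐟)

  derives-junk : ∀ {s s₁} → Junk s s₁ → Derives R s s₁
  derives-junk (push k)  = letter 𝐚 ·/ derives-busy k ·/ letter 𝐟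
  derives-junk (pop k l) = letter 𝐛 ·/ derives-body k ·/ derives-stop l

  derives-stop : ∀ {s s₁} → Stop s s₁ → Derives Q s s₁
  derives-stop here     = letter 𝐪
  derives-stop (root k) = letter 𝐳 ·/ derives-busy k ·/ letter 𝐟

  derives-busy : ∀ {s s₁} → Busy s s₁ → Derives Y s s₁
  derives-busy (base k)     = letter 𝐲 ·/ derives-body k
  derives-busy (unit k)     = letter 𝐨 ·/ derives-busy k ·/ letter 𝐜
  derives-busy (next k l m) =
    derives-idle k ·⧵ (letter #₁ ·/ derives-idle l ·/ (letter 𝐚 ·/ derives-busy m) ·/ letter 𝐟 ·/ letter 𝐰)
  derives-busy (first k l)  = derives-idle k ·⧵ (letter #₂ ·/ derives-idle l ·/ letter 𝐛 ·/ letter 𝐞)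

  derives-body : ∀ {s s₁} → Body s s₁ → Derives X s s₁
  derives-body x-      = letter 𝐱
  derives-body e-      = letter 𝐞 ·/ letter 𝐜
  derives-body (k -c)  = derives-body k ·⧵ letter 𝐜
  derives-body (k -fw) = derives-body k ·⧵ letter 𝐟 ·⧵ letter 𝐰

pointwise-category : ∀ w → Pointwise _▷_ w (map category w)
pointwise-category []      = []
pointwise-category (ω ∷ w) = ▷-category ω ∷ pointwise-category w

busy⇒language : ∀ {s} → Busy s [] → CategorialGrammar.language grammar (𝐳 ∷ s)
busy⇒language {s} k with letter 𝐳 ·/ derives-busy k
... | derives u eq r with refl ← trans eq (++-identityʳ u) =
  (λ ()) , map category (𝐳 ∷ s) , pointwise-category (𝐳 ∷ s) , r

-- The encoding

cs os : ℕ → List Letter → List Letter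
cs zero    k = k
cs (suc n) k = 𝐜 ∷ cs n k
os zero    k = k
os (suc n) k = 𝐨 ∷ os n k

base-string : ℕ → List Letter → List Letter
base-string n k = 𝐲 ∷ 𝐱 ∷ cs n (𝐟 ∷ k)

-- If the counter is not used, base-string n is where its n letters 𝐨 are matched; otherwise
-- base-string n is skipped.
push-unit : ℕ → List Letter → List Letter
push-unit n k = 𝐚 ∷ os n (base-string n k)

-- The last number is subtracted, all others are values of popped counters.
levels : ℕ → List ℕ → List Letter → List Letter
levels m []        k = cs m k
levels m (m′ ∷ ms) k = cs m (𝐟 ∷ 𝐰 ∷ levels m′ ms k)

-- When the unit is skipped, 𝐞 takes one 𝐜 of the first level. When it is used, `#₂` takes 𝐛 and 𝐞,
-- and the levels are left to the letters 𝐨.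
pop-unit : ℕ × List ℕ → List Letter → List Letter
pop-unit (m , ms) k = 𝐛 ∷ 𝐞 ∷ levels m ms (𝐪 ∷ k)

push-units : List ℕ → List Letter → List Letter
push-units ns k = foldr push-unit k ns

pop-units : List (ℕ × List ℕ) → List Letter → List Letter
pop-units νs k = foldr pop-unit k νs

cs-++ : ∀ n k l → cs n k ++ l ≡ cs n (k ++ l)
cs-++ zero    k l = refl
cs-++ (suc n) k l = cong (𝐜 ∷_) (cs-++ n k l)

os-++ : ∀ n k l → os n k ++ l ≡ os n (k ++ l)
os-++ zero    k l = refl
os-++ (suc n) k l = cong (𝐨 ∷_) (os-++ n k l)

base-string-++ : ∀ n k l → base-string n k ++ l ≡ base-string n (k ++ l)
base-string-++ n k l = cong (λ s → 𝐲 ∷ 𝐱 ∷ s) (cs-++ n (𝐟 ∷ k) l)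

own-++ : ∀ n k l → os n (base-string n k) ++ l ≡ os n (base-string n (k ++ l))
own-++ n k l = trans (os-++ n _ l) (cong (os n) (base-string-++ n k l))

levels-++ : ∀ m ms k l → levels m ms k ++ l ≡ levels m ms (k ++ l)
levels-++ m []        k l = cs-++ m k l
levels-++ m (m′ ∷ ms) k l = trans (cs-++ m _ l) (cong (λ s → cs m (𝐟 ∷ 𝐰 ∷ s)) (levels-++ m′ ms k l))

push-units-++ : ∀ ns k l → push-units ns k ++ l ≡ push-units ns (k ++ l)
push-units-++ []       k l = refl
push-units-++ (n ∷ ns) k l =
  cong (𝐚 ∷_) (trans (own-++ n _ l) (cong (λ s → os n (base-string n s)) (push-units-++ ns k l)))

pop-units-++ : ∀ νs k l → pop-units νs k ++ l ≡ pop-units νs (k ++ l)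
pop-units-++ []              k l = refl
pop-units-++ ((m , ms) ∷ νs) k l =
  cong (λ s → 𝐛 ∷ 𝐞 ∷ s) (trans (levels-++ m ms _ l) (cong (λ s → levels m ms (𝐪 ∷ s)) (pop-units-++ νs k l)))

module Encoding (Σ : Set) (Pushes : Σ → List ℕ) (Pops : Σ → List (ℕ × List ℕ)) (m₀ N : ℕ) where

  -- The closing 𝐪 of this unit is missing, and so it can be used only at the end of the string, where
  -- m₀ is on top of the initial counter N.  When it is not used, the next block begins with a string
  -- of category Q.
  final-unit : List Letter → List Letter
  final-unit k = 𝐛 ∷ 𝐞 ∷ levels m₀ (N ∷ []) k

  idles : List (ℕ × List ℕ)
  idles = (1 , []) ∷ []

  -- The `base-string 0` provides the `T` to which skipped units attach. After the push and the
  -- operation from `Pops`, a third operation either subtracts 1 or is `final-unit`.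
  block₁ block₂ : Σ → List Letter → List Letter
  block₃ : List Letter → List Letter
  block₃ k   = #₂ ∷ base-string 0 (pop-units idles (final-unit k))
  block₂ α k = #₂ ∷ base-string 0 (pop-units (Pops α) (block₃ k))
  block₁ α k = #₁ ∷ base-string 0 (push-units (Pushes α) (block₂ α k))

  block : Σ → List Letter → List Letter
  block α k = 𝐳 ∷ os N (base-string N (block₁ α k))

  encode : List Σ → List Letter
  encode []       = []
  encode (α ∷ ws) = block α (encode ws)

  hom : Σ → List⁺ Letter
  hom α = 𝐳 ∷ os N (base-string N (block₁ α []))

  final-unit-++ : ∀ k l → final-unit k ++ l ≡ final-unit (k ++ l)
  final-unit-++ k l = cong (λ s → 𝐛 ∷ 𝐞 ∷ s) (levels-++ m₀ (N ∷ []) k l)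

  block₃-++ : ∀ k l → block₃ k ++ l ≡ block₃ (k ++ l)
  block₃-++ k l = cong (λ s → #₂ ∷ 𝐲 ∷ 𝐱 ∷ 𝐟 ∷ 𝐛 ∷ 𝐞 ∷ 𝐜 ∷ 𝐪 ∷ s) (final-unit-++ k l)

  block₂-++ : ∀ α k l → block₂ α k ++ l ≡ block₂ α (k ++ l)
  block₂-++ α k l = cong (λ s → #₂ ∷ 𝐲 ∷ 𝐱 ∷ 𝐟 ∷ s)
    (trans (pop-units-++ (Pops α) _ l) (cong (pop-units (Pops α)) (block₃-++ k l)))

  block₁-++ : ∀ α k l → block₁ α k ++ l ≡ block₁ α (k ++ l)
  block₁-++ α k l = cong (λ s → #₁ ∷ 𝐲 ∷ 𝐱 ∷ 𝐟 ∷ s)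
    (trans (push-units-++ (Pushes α) _ l) (cong (push-units (Pushes α)) (block₂-++ α k l)))

  block-++ : ∀ α k l → block α k ++ l ≡ block α (k ++ l)
  block-++ α k l = cong (𝐳 ∷_) (trans (own-++ N _ l) (cong (λ s → os N (base-string N s)) (block₁-++ α k l)))

  homomorphism≡encode : ∀ w → homomorphism hom w ≡ encode w
  homomorphism≡encode []      = refl
  homomorphism≡encode (α ∷ w) =
    trans (cong (block α [] ++_) (homomorphism≡encode w)) (block-++ α [] (encode w))

  -- Runs of the stack machine

  data Kind : Set where
    pushed rooted : Kind

  -- Counter κ d ws₀ ws: a counter created when ws₀ remained to be read may have the value d when
  -- ws remains to be read.  After is the same at a time when block₃ of the current block is still to
  -- be read.  In Popping, it is the counter now on top whose value is d, and it faces the level m.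
  mutual
    data Counter : Kind → ℕ → List Σ → List Σ → Set where
      created : ∀ {ws} → Counter rooted N ws ws
      skip : ∀ {κ d ws₀ ws} → After κ (suc d) ws₀ ws → Counter κ d ws₀ ws
      -- A use of `final-unit` before the end of the word. Parsing cannot exclude it; the bounds
      -- `class<N` and `rooted-bound` make it harmless.
      exit : ∀ {κ d ws₀ ws₁ ws} → After pushed m₀ ws₁ ws → Counter κ (N + d) ws₀ ws₁ → Counter κ d ws₀ ws

    data After : Kind → ℕ → List Σ → List Σ → Set where
      subtract : ∀ {κ α m d ws₀ ws} → Popping κ α ws m [] (m + d) ws₀ → After κ d ws₀ ws

    data Popping : Kind → Σ → List Σ → ℕ → List ℕ → ℕ → List Σ → Set where
      top : ∀ {α ws m ms d} → (m , ms) ∈ˡ Pops α → d ∈ˡ Pushes α → Popping pushed α ws m ms d (α ∷ ws)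
      -- Value and level are both `m`, so the upper counter is popped. The lower one still has the
      -- value that it had at `ws₁`, when the upper one was created.
      below : ∀ {κ α ws m m′ ms d ws₀ ws₁} → Popping pushed α ws m (m′ ∷ ms) m ws₁ →
            Counter κ d ws₀ ws₁ → Popping κ α ws m′ ms d ws₀

  Positive : ℕ → List ℕ → Set
  Positive m []        = 1 ≤ m
  Positive m (m′ ∷ ms) = Positive m′ ms

  -- From parses of the encoding to runs

  module Parsing (positive : ∀ {α m ms} → (m , ms) ∈ˡ Pops α → Positive m ms) (1≤N : 1 ≤ N) where

    -- The lists hold the units still ahead among the current alternatives; `All` keeps the one fact
    -- about them that the proof uses.
    data Place : Set where
      pushing : ∀ α ns (ws : List Σ) → All (_∈ˡ Pushes α) ns → Place
      popping : ∀ α νs (ws : List Σ) → All (_∈ˡ Pops α) νs → Place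
      ending  : ∀ νs (ws : List Σ) → All (_∈ˡ idles) νs → Place
      start   : ∀ (α : Σ) (ws : List Σ) → Place

    string : Place → List Letter
    string (pushing α ns ws _) = push-units ns (block₂ α (encode ws))
    string (popping α νs ws _) = pop-units νs (block₃ (encode ws))
    string (ending νs ws _)    = pop-units νs (final-unit (encode ws))
    string (start α ws)        = block₁ α (encode ws)

    data Context : Set where
      in-pops  : ∀ α νs (ws : List Σ) → All (_∈ˡ Pops α) νs → Context
      in-idles : ∀ νs (ws : List Σ) → All (_∈ˡ idles) νs → Context
      in-final : (ws : List Σ) → Context

    rest : Context → List Letter
    rest (in-pops α νs ws p) = 𝐪 ∷ string (popping α νs ws p)
    rest (in-idles νs ws p)  = 𝐪 ∷ string (ending νs ws p)
    rest (in-final ws)       = encode ws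

    data Region : Set where
      pushes pops : Σ → List Σ → Region
      ends        : List Σ → Region

    -- Idle and Busy strings begin at the letters 𝐨 of a counter, or else at the base-string 0
    -- after #₁ or #₂, which behaves like an empty counter of origin dummy.
    data Origin : Set where
      real  : Kind → List Σ → Origin
      dummy : Region → Origin

    At : Origin → Place → ℕ → Set
    -- Only the counter just pushed can stop among push units: an older one crosses `#₁` inside
    -- `next`, which ends within a popping unit.
    At (real κ ws₀) (pushing α ns ws _) d = κ ≡ pushed × ws₀ ≡ α ∷ ws × d ∈ˡ Pushes α
    At (real κ ws₀) (popping α νs ws _) d = After κ d ws₀ ws
    At (real κ ws₀) (ending νs ws _)    d = Counter κ d ws₀ ws
    At (real κ ws₀) (start α ws)        d = Counter κ d ws₀ (α ∷ ws)
    At (dummy (pushes α ws)) (pushing α′ ns ws′ _) d = α′ ≡ α × ws′ ≡ ws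
    At (dummy (pops α ws)) (popping α′ νs ws′ _) d = α′ ≡ α × ws′ ≡ ws
    At (dummy (ends ws))    (ending νs ws′ _)     d = ws′ ≡ ws
    -- A dummy may drift past `final-unit` into the next block, but after `#₂` an `Idle` string has
    -- to end before 𝐛, so nothing needs to be known here.
    At (dummy (ends ws))    (start α ws′)         d = ⊤
    At (dummy _)              _                     d = ⊥

    In : Origin → Context → ℕ → List ℕ → ℕ → Set
    In (real κ ws₀) (in-pops α νs ws _) m ms d = Popping κ α ws m ms d ws₀
    In (real κ ws₀) (in-idles νs ws _)    m ms d = m ≡ 1 × ms ≡ [] × After κ d ws₀ ws
    In (real κ ws₀) (in-final ws)          m ms d =
      (m ≡ m₀ × ms ≡ N ∷ [] × After κ d ws₀ ws) ⊎
      (m ≡ N × ms ≡ [] × ∃[ ws₁ ] (After pushed m₀ ws₁ ws × Counter κ d ws₀ ws₁))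
    In (dummy _) _ _ _ _ = ⊤

    Initial : Origin → Place → ℕ → Set
    Initial (real κ ws₀) p n = At (real κ ws₀) p n
    Initial (dummy r)    p n = n ≡ 0 × At (dummy r) p n

    initial-at : ∀ o p {n} → Initial o p n → At o p n
    initial-at (real _ _) p i       = i
    initial-at (dummy _)  p (_ , i) = i

    -- Here j is the number of letters 𝐨 in the string, out of d + j letters of the counter; k is how
    -- many letters of the current level have been used.
    data BusyEnd (o : Origin) (p : Place) (d j : ℕ) (s : List Letter) : Set where
      own : ∀ i → s ≡ cs i (𝐟 ∷ string p) → BusyEnd o p d j s
      neg : ∀ c m ms k k′ → s ≡ levels k′ ms (rest c) → k + k′ ≡ m → Positive m ms → k ≤ j →
            In o c m ms (d + k) → BusyEnd o p d j s

    IdleEnd : Origin → ℕ → List Letter → Set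
    IdleEnd o d s = ∃[ p ] (s ≡ string p × At o p d)

    string≢w : ∀ p {s} → string p ≡ 𝐰 ∷ s → ⊥
    string≢w (pushing α [] ws _) ()
    string≢w (pushing α (_ ∷ _) ws _) ()
    string≢w (popping α [] ws _) ()
    string≢w (popping α (_ ∷ _) ws _) ()
    string≢w (ending [] ws _) ()
    string≢w (ending (_ ∷ _) ws _) ()
    string≢w (start α ws) ()

    rest≢c : ∀ c {s} → rest c ≡ 𝐜 ∷ s → ⊥
    rest≢c (in-pops _ _ _ _) ()
    rest≢c (in-idles _ _ _) ()
    rest≢c (in-final []) ()
    rest≢c (in-final (_ ∷ _)) ()

    rest≢f : ∀ c {s} → rest c ≡ 𝐟 ∷ s → ⊥
    rest≢f (in-pops _ _ _ _) ()
    rest≢f (in-idles _ _ _) ()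
    rest≢f (in-final []) ()
    rest≢f (in-final (_ ∷ _)) ()

    -- The 𝐟 that closes a base string is not followed by 𝐰, so the automaton cannot step over it.
    body-base : ∀ n p {s s₁} → Body s s₁ → s ≡ 𝐱 ∷ cs n (𝐟 ∷ string p) →
                ∃[ i ] s₁ ≡ cs i (𝐟 ∷ string p)
    body-base n p x- refl = n , refl
    body-base n p (b -c) eq with body-base n p b eq
    ... | suc i , refl = i , refl
    body-base n p (b -fw) eq with body-base n p b eq
    ... | zero , eq′ with () ← string≢w p (sym (∷-injectiveʳ eq′))

    body-levels : ∀ c m ms {s s₁} → Body s s₁ → s ≡ 𝐞 ∷ levels m ms (rest c) →
                  ∃[ k ] ∃[ ms′ ] s₁ ≡ levels k ms′ (rest c)
    body-levels c (suc m) [] e- refl = m , [] , refl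
    body-levels c (suc m) (m′ ∷ ms) e- refl = m , m′ ∷ ms , refl
    body-levels c zero [] e- eq with rest c in eq′
    body-levels c zero [] e- refl | _ with () ← rest≢c c eq′
    body-levels c m ms (b -c) eq with body-levels c m ms b eq
    ... | suc k , [] , refl = k , [] , refl
    ... | suc k , m′ ∷ ms′ , refl = k , m′ ∷ ms′ , refl
    ... | zero , [] , eq′ with () ← rest≢c c (sym eq′)
    body-levels c m ms (b -fw) eq with body-levels c m ms b eq
    ... | zero , m′ ∷ ms′ , refl = m′ , ms′ , refl
    ... | zero , [] , eq′ with () ← rest≢f c (sym eq′)

    levels-stop : ∀ c k ms {s s₁} → Stop s s₁ → s ≡ levels k ms (rest c) → k ≡ 0 × ms ≡ [] × s ≡ rest c
    levels-stop c zero    []       st       eq = refl , refl , eq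
    levels-stop c zero    (_ ∷ _)  here     ()
    levels-stop c zero    (_ ∷ _)  (root _) ()
    levels-stop c (suc k) []       here     ()
    levels-stop c (suc k) []       (root _) ()
    levels-stop c (suc k) (_ ∷ _)  here     ()
    levels-stop c (suc k) (_ ∷ _)  (root _) ()

    levels-f : ∀ c k ms {s} → 𝐟 ∷ s ≡ levels k ms (rest c) →
               k ≡ 0 × ∃[ m′ ] ∃[ ms′ ] (ms ≡ m′ ∷ ms′ × s ≡ 𝐰 ∷ levels m′ ms′ (rest c))
    levels-f c zero []         eq with () ← rest≢f c (sym eq)
    levels-f c zero (m′ ∷ ms′) refl = refl , m′ , ms′ , refl , refl
    levels-f c (suc k) []      ()
    levels-f c (suc k) (_ ∷ _) ()

    levels-c : ∀ c k ms {s} → 𝐜 ∷ s ≡ levels k ms (rest c) → ∃[ k′ ] (k ≡ suc k′ × s ≡ levels k′ ms (rest c))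
    levels-c c zero []          eq with () ← rest≢c c (sym eq)
    levels-c c (suc k) []      refl = k , refl , refl
    levels-c c (suc k) (_ ∷ _) refl = k , refl , refl

    in-next : ∀ o c {m m′ ms α ws} {d} → In (real pushed (α ∷ ws)) c m (m′ ∷ ms) m → At o (start α ws) d → In o c m′ ms d
    in-next (real κ ws₀) (in-pops α νs ws _) i a = below i a
    in-next (real κ ws₀) (in-final ws) (inj₁ (refl , refl , i)) a = inj₂ (refl , refl , _ , i , a)
    in-next (dummy _) c i a = tt

    -- A dummy has no letters 𝐨, while completing a last level costs at least one by `Positive`.
    -- Hence only a real counter can return from `Busy` to `Idle` by `stop`.
    real-origin : ∀ o p {n m} d j → Initial o p n → d + j ≡ n → m ≤ j → 1 ≤ m →
                  ∃[ κ ] ∃[ ws₀ ] o ≡ real κ ws₀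
    real-origin (real κ ws₀) p d j i eq m≤j 1≤m = κ , ws₀ , refl
    real-origin (dummy r)    p d j (refl , _) eq m≤j 1≤m
      with refl ← m+n≡0⇒n≡0 d eq with () ← ≤-trans 1≤m m≤j

    mutual
      -- The last hypothesis excludes a junk string that starts with 𝐚, or a string of category `Q`
      -- that starts with 𝐳, and takes its final 𝐟 from a pair 𝐟 𝐰 of a later popping unit. Such
      -- strings are derivable, but the 𝐰 left behind fits no continuation.
      idle-end : ∀ o p n d j {s s₁} → Idle s s₁ → s ≡ os j (base-string n (string p)) → Initial o p n → d + j ≡ n →
                 (∀ {s₂} → s₁ ≡ 𝐰 ∷ s₂ → ⊥) → IdleEnd o d s₁
      idle-end o p n d zero (base b) refl i refl ≢w with body-base n p b refl
      ... | zero , refl = p , refl , subst (At o p) (+-identityʳ d) (initial-at o p i)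
      idle-end o p n d (suc j) (base b) () i eq ≢w
      idle-end o p n d j (k ∙ l) s≡ i eq ≢w with idle-end o p n d j k s≡ i eq (junk≢w l)
        where
        junk≢w : ∀ {s s₁} → Junk s s₁ → ∀ {s₂} → s ≡ 𝐰 ∷ s₂ → ⊥
        junk≢w (push _) ()
        junk≢w (pop _ _) ()
      ... | p′ , eq′ , a = junk-end o p′ l eq′ a ≢w
      idle-end o p n d j (stop k l) s≡ i eq ≢w with busy-end o p n d j k s≡ i eq
      ... | own (suc m) refl with () ← l
      ... | own zero refl with () ← l
      ... | neg c m ms k₁ k′ eq₁ k+k′ pos k≤j a with levels-stop c k′ ms l eq₁
      ... | refl , refl , eq₂ =
        stop-end o c l eq₂ (subst (λ v → In o c v [] (d + k₁)) (trans (sym k+k′) (+-identityʳ k₁)) a)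
          (real-origin o p d j i eq k≤j (subst (1 ≤_) (trans (sym k+k′) (+-identityʳ k₁)) pos)) ≢w

      junk-end : ∀ o p {s s₁ d} → Junk s s₁ → s ≡ string p → At o p d → (∀ {s₂} → s₁ ≡ 𝐰 ∷ s₂ → ⊥) → IdleEnd o d s₁
      junk-end o (pushing α (n ∷ ns) ws (n∈ ∷ ns∈)) (push k) refl a ≢w
        with busy-end (real pushed (α ∷ ws)) (pushing α ns ws ns∈) n 0 n k refl (refl , refl , n∈) refl
      ... | own zero eq₁ = pushing α ns ws ns∈ , ∷-injectiveʳ eq₁ , move o a
        where
        move : ∀ o {d} → At o (pushing α (n ∷ ns) ws (n∈ ∷ ns∈)) d → At o (pushing α ns ws ns∈) d
        move (real _ _) a = a
        move (dummy (pushes _ _)) a = a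
      ... | neg c m ms k₁ k′ eq₁ _ _ _ _ with levels-f c k′ ms eq₁
      ... | _ , _ , _ , _ , eq₂ with () ← ≢w eq₂
      junk-end o (pushing α [] ws _) (push k) ()
      junk-end o (pushing α [] ws _) (pop k l) ()
      junk-end o (pushing α (_ ∷ _) ws _) (pop k l) ()
      junk-end o (popping α [] ws _) (push k) ()
      junk-end o (popping α [] ws _) (pop k l) ()
      junk-end o (popping α (_ ∷ _) ws _) (push k) ()
      junk-end o (popping α ((m , ms) ∷ νs) ws (_ ∷ νs∈)) (pop b l) refl a ≢w
        with body-levels (in-pops α νs ws νs∈) m ms b refl
      ... | k , ms′ , eq with levels-stop (in-pops α νs ws νs∈) k ms′ l eq
      ... | _ , _ , refl with here ← l = popping α νs ws νs∈ , refl , move o a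
        where
        move : ∀ o {d} → At o (popping α ((m , ms) ∷ νs) ws (_ ∷ νs∈)) d → At o (popping α νs ws νs∈) d
        move (real _ _) a = a
        move (dummy (pops _ _)) a = a
      junk-end o (ending [] ws _) (push k) ()
      junk-end o (ending (_ ∷ _) ws _) (push k) ()
      junk-end o (ending ((m , ms) ∷ νs) ws (_ ∷ νs∈)) (pop b l) refl a ≢w
        with body-levels (in-idles νs ws νs∈) m ms b refl
      ... | k , ms′ , eq with levels-stop (in-idles νs ws νs∈) k ms′ l eq
      ... | _ , _ , refl with here ← l = ending νs ws νs∈ , refl , move o a
        where
        move : ∀ o {d} → At o (ending ((m , ms) ∷ νs) ws (_ ∷ νs∈)) d → At o (ending νs ws νs∈) d
        move (real _ _) a = a
        move (dummy (ends _)) a = a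
      junk-end o (ending [] ws p∈) (pop b l) refl a ≢w with body-levels (in-final ws) m₀ (N ∷ []) b refl
      ... | k , ms′ , eq with levels-stop (in-final ws) k ms′ l eq
      ... | _ , _ , eq′ with root-end ws l eq′ ≢w
      ... | α , ws′ , refl , refl = start α ws′ , refl , move o a
        where
        move : ∀ o {d} → At o (ending [] (α ∷ ws′) p∈) d → At o (start α ws′) d
        move (real _ _) a = a
        move (dummy (ends _)) a = tt
      junk-end o (start α ws) (push k) ()
      junk-end o (start α ws) (pop b l) ()

      root-end : ∀ ws {s s₁} → Stop s s₁ → s ≡ encode ws → (∀ {s₂} → s₁ ≡ 𝐰 ∷ s₂ → ⊥) →
                 ∃[ α ] ∃[ ws′ ] (ws ≡ α ∷ ws′ × s₁ ≡ block₁ α (encode ws′))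
      root-end [] here ()
      root-end [] (root k) ()
      root-end (α ∷ ws) here ()
      root-end (α ∷ ws) (root k) refl ≢w
        with busy-end (real rooted (α ∷ ws)) (start α ws) N 0 N k refl created refl
      ... | own zero eq₁ = α , ws , refl , ∷-injectiveʳ eq₁
      ... | neg c m ms k₁ k′ eq₁ _ _ _ _ with levels-f c k′ ms eq₁
      ... | _ , _ , _ , _ , eq₂ with () ← ≢w eq₂

      stop-end : ∀ o c {m d s s₁} → Stop s s₁ → s ≡ rest c → In o c m [] (d + m) →
                 ∃[ κ ] ∃[ ws₀ ] o ≡ real κ ws₀ → (∀ {s₂} → s₁ ≡ 𝐰 ∷ s₂ → ⊥) → IdleEnd o d s₁
      stop-end _ (in-pops α νs ws νs∈) {m} {d} here refl i (κ , ws₀ , refl) ≢w =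
        popping α νs ws νs∈ , refl , subtract (subst (λ v → Popping κ α ws m [] v ws₀) (+-comm d m) i)
      stop-end _ (in-pops α νs ws νs∈) (root _) ()
      stop-end _ (in-idles νs ws νs∈) {d = d} here refl (refl , _ , i) (κ , ws₀ , refl) ≢w =
        ending νs ws νs∈ , refl , skip (subst (λ v → After κ v ws₀ ws) (+-comm d 1) i)
      stop-end _ (in-idles νs ws νs∈) (root _) ()
      stop-end _ (in-final ws) {d = d} l eq i (κ , ws₀ , refl) ≢w with root-end ws l eq ≢w
      stop-end _ (in-final _) l eq (inj₁ (_ , () , _)) (κ , ws₀ , refl) ≢w | _
      stop-end _ (in-final _) {d = d} l eq (inj₂ (refl , _ , ws₁ , i , b)) (κ , ws₀ , refl) ≢w | α , ws′ , refl , refl =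
        start α ws′ , refl , exit i (subst (λ v → Counter κ v ws₀ ws₁) (+-comm d N) b)

      busy-end : ∀ o p n d j {s s₁} → Busy s s₁ → s ≡ os j (base-string n (string p)) → Initial o p n → d + j ≡ n →
                 BusyEnd o p d j s₁
      busy-end o p n d zero (base b) refl i eq with body-base n p b refl
      ... | i′ , eq′ = own i′ eq′
      busy-end o p n d (suc j) (base b) ()
      busy-end o p n d zero (unit k) ()
      -- The leading 𝐨 is counted in `d` for the shorter string, and in `k` once it has found its 𝐜
      -- in a level.
      busy-end o p n d (suc j) (unit k) refl i eq
        with busy-end o p n (suc d) j k refl i (trans (sym (+-suc d j)) eq)
      ... | own zero ()
      ... | own (suc i′) refl = own i′ refl
      ... | neg c m ms k₁ k′ eq₁ k+k′ pos k≤j a with levels-c c k′ ms eq₁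
      ... | k″ , refl , eq₂ =
        neg c m ms (suc k₁) k″ eq₂ (trans (sym (+-suc k₁ k″)) k+k′) pos (s≤s k≤j)
          (subst (In o c m ms) (sym (+-suc d k₁)) a)
      busy-end o p n d j (next k l k₁) s≡ i eq with idle-end o p n d j k s≡ i eq (λ ())
      ... | pushing α [] ws _ , () , _
      ... | pushing α (_ ∷ _) ws _ , () , _
      ... | popping α [] ws _ , () , _
      ... | popping α (_ ∷ _) ws _ , () , _
      ... | ending [] ws _ , () , _
      ... | ending (_ ∷ _) ws _ , () , _
      ... | start α ws , refl , a
        with idle-end (dummy (pushes α ws)) (pushing α (Pushes α) ws (All.tabulate λ n∈ → n∈)) 0 0 0
               l refl (refl , refl , refl) refl (λ ())
      ... | pushing α [] ws _ , () , _
      ... | popping α [] ws _ , () , _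
      ... | popping α (_ ∷ _) ws _ , () , _
      ... | ending [] ws _ , () , _
      ... | ending (_ ∷ _) ws _ , () , _
      ... | start α ws , () , _
      ... | pushing α (n′ ∷ ns) ws (n∈ ∷ ns∈) , refl , refl , refl
        with busy-end (real pushed (α ∷ ws)) (pushing α ns ws ns∈) n′ 0 n′ k₁ refl (refl , refl , n∈) refl
      ... | own zero eq₁ with () ← string≢w (pushing α ns ws ns∈) (sym (∷-injectiveʳ eq₁))
      -- The string contains all letters 𝐨 of the new counter, so at its end the value is used up.
      -- The 𝐟 that follows shows that the level is used up too. They are therefore equal, and the
      -- older counter meets the next level.
      ... | neg c m ms k₂ k′ eq₁ k+k′ pos k≤j b with levels-f c k′ ms eq₁
      ... | refl , m′ , ms′ , refl , refl =
        neg c m′ ms′ 0 m′ refl refl pos z≤n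
          (subst (In o c m′ ms′) (sym (+-identityʳ d))
            (in-next o c (subst (In (real pushed (α ∷ ws)) c m (m′ ∷ ms′)) (trans (sym (+-identityʳ k₂)) k+k′) b) a))
      busy-end o p n d j (first k l) s≡ i eq with idle-end o p n d j k s≡ i eq (λ ())
      ... | pushing α (_ ∷ _) ws _ , () , _
      ... | popping α (_ ∷ _) ws _ , () , _
      ... | ending [] ws _ , () , _
      ... | ending (_ ∷ _) ws _ , () , _
      ... | start α ws , () , _
      ... | pushing α [] ws ns∈ , refl , a
        with idle-end (dummy (pops α ws)) (popping α (Pops α) ws (All.tabulate λ ν∈ → ν∈)) 0 0 0
               l refl (refl , refl , refl) refl (λ ())
      ... | pushing α [] ws _ , () , _
      ... | pushing α (_ ∷ _) ws _ , () , _
      ... | popping α [] ws _ , () , _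
      ... | ending [] ws _ , _ , ()
      ... | ending (_ ∷ _) ws _ , _ , ()
      ... | start α ws , () , _
      ... | popping α ((m , ms) ∷ νs) ws (ν∈ ∷ νs∈) , refl , refl , refl =
        neg (in-pops α νs ws νs∈) m ms 0 m refl refl (positive ν∈) z≤n
          (subst (In o (in-pops α νs ws νs∈) m ms) (sym (+-identityʳ d)) (enter o a))
        where
        enter : ∀ o → At o (pushing α [] ws ns∈) d → In o (in-pops α νs ws νs∈) m ms d
        enter (real _ _) (refl , refl , d∈) = top ν∈ d∈
        enter (dummy _) _ = tt
      busy-end o p n d j (first k l) s≡ i eq | popping α [] ws _ , refl , a
        with idle-end (dummy (ends ws)) (ending idles ws (All.tabulate λ ν∈ → ν∈)) 0 0 0
               l refl (refl , refl) refl (λ ())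
      ... | pushing α [] ws _ , () , _
      ... | pushing α (_ ∷ _) ws _ , () , _
      ... | popping α [] ws _ , () , _
      ... | popping α (_ ∷ _) ws _ , _ , ()
      ... | start α ws , () , _
      ... | ending [] ws _ , refl , refl =
        neg (in-final ws) m₀ (N ∷ []) 0 m₀ refl refl 1≤N z≤n
          (subst (In o (in-final ws) m₀ (N ∷ [])) (sym (+-identityʳ d)) (enter o a))
        where
        enter : ∀ o → At o (popping α [] ws _) d → In o (in-final ws) m₀ (N ∷ []) d
        enter (real _ _) a = inj₁ (refl , refl , a)
        enter (dummy _) _ = tt
      ... | ending (_ ∷ νs) ws (here refl ∷ νs∈) , refl , refl =
        neg (in-idles νs ws νs∈) 1 [] 0 1 refl refl (s≤s z≤n) z≤n
          (subst (In o (in-idles νs ws νs∈) 1 []) (sym (+-identityʳ d)) (enter o a))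
        where
        enter : ∀ o → At o (popping α [] ws _) d → In o (in-idles νs ws νs∈) 1 [] d
        enter (real _ _) a = refl , refl , a
        enter (dummy _) _ = tt

    -- Among all contexts only `in-final []` has an empty rest. There the initial counter must be
    -- exhausted by the level `N`, under a popped counter of value `m₀`.
    accepted : ∀ α ws → Busy (os N (base-string N (block₁ α (encode ws)))) [] →
               ∃[ ws₁ ] (After pushed m₀ ws₁ [] × Counter rooted N (α ∷ ws) ws₁)
    accepted α ws k with busy-end (real rooted (α ∷ ws)) (start α ws) N 0 N k refl created refl
    ... | own zero ()
    ... | own (suc _) ()
    ... | neg (in-final []) m [] k₁ zero refl _ _ _ (inj₁ (_ , () , _))
    ... | neg (in-final []) m [] k₁ zero refl k₁+0 _ _ (inj₂ (refl , _ , ws₁ , a , b)) =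
      ws₁ , a , subst (λ v → Counter rooted v (α ∷ ws) ws₁) (trans (sym (+-identityʳ k₁)) k₁+0) b
    ... | neg (in-final (_ ∷ _)) m [] k₁ zero () _ _ _ _
    ... | neg (in-pops _ _ _ _) m [] k₁ zero () _ _ _ _
    ... | neg (in-idles _ _ _) m [] k₁ zero () _ _ _ _
    ... | neg c m (_ ∷ _) k₁ zero () _ _ _ _
    ... | neg c m [] k₁ (suc _) () _ _ _ _
    ... | neg c m (_ ∷ _) k₁ (suc _) () _ _ _ _

-- Numbering the elements of finite types

module _ {A : Set} (fin : Finite A) where
  open Inverse (proj₂ fin) using (to; from; strictlyInverseˡ; strictlyInverseʳ)

  card : ℕ
  card = proj₁ fin

  index : A → ℕ
  index = toℕ ∘ to

  index<card : ∀ a → index a < card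
  index<card a = toℕ<n (to a)

  index-injective : ∀ {a b} → index a ≡ index b → a ≡ b
  index-injective {a} {b} eq =
    trans (sym (strictlyInverseʳ a)) (trans (cong from (toℕ-injective eq)) (strictlyInverseʳ b))

  elements : List A
  elements = map from (allFin card)

  ∈-elements : ∀ a → a ∈ˡ elements
  ∈-elements a = subst (_∈ˡ elements) (strictlyInverseʳ a) (∈-map⁺ from (∈-allFin (to a)))

-- From runs to parses of the encoding

os-+ : ∀ m n k → os (m + n) k ≡ os m (os n k)
os-+ zero    n k = refl
os-+ (suc m) n k = cong (𝐨 ∷_) (os-+ m n k)

cs-comm : ∀ n (k : List Letter) → 𝐜 ∷ cs n k ≡ cs n (𝐜 ∷ k)
cs-comm zero    k = refl
cs-comm (suc n) k = cong (𝐜 ∷_) (cs-comm n k)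

busy-units : ∀ n {s k} → Busy s (cs n k) → Busy (os n s) k
busy-units zero    b = b
busy-units (suc n) b = unit (busy-units n (subst (Busy _) (cs-comm n _) b))

body-units : ∀ n {s k} → Body s (cs n k) → Body s k
body-units zero    b = b
body-units (suc n) b = body-units n (b -c)

body-all-levels : ∀ m ms {s k} → Body s (levels m ms k) → Body s k
body-all-levels m []        b = body-units m b
body-all-levels m (m′ ∷ ms) b = body-all-levels m′ ms (body-units m b -fw)

body-pop : ∀ m ms {k} → 1 ≤ m → Body (𝐞 ∷ levels m ms k) k
body-pop (suc m) []        _ = body-units m e-
body-pop (suc m) (m′ ∷ ms) _ = body-all-levels m′ ms (body-units m e- -fw)

idle-base : ∀ n {k} → Idle (base-string n k) k
idle-base n = base (body-units n x-)

busy-own : ∀ n {k} → Busy (os n (base-string n k)) (𝐟 ∷ k)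
busy-own n = busy-units n (base x-)

skip-pushes : ∀ ns {s k} → Idle s (push-units ns k) → Idle s k
skip-pushes []       i = i
skip-pushes (n ∷ ns) i = skip-pushes ns (i ∙ push (busy-own n))

skip-pops : ∀ νs {s k} → All (λ ν → 1 ≤ proj₁ ν) νs → Idle s (pop-units νs k) → Idle s k
skip-pops []             []       i = i
skip-pops ((m , ms) ∷ νs) (p ∷ ps) i = skip-pops νs ps (i ∙ pop (body-pop m ms p) here)

module Building (Σ : Set) (Pushes : Σ → List ℕ) (Pops : Σ → List (ℕ × List ℕ)) (m₀ N : ℕ)
                (first-positive : ∀ α → All (λ ν → 1 ≤ proj₁ ν) (Pops α)) (1≤m₀ : 1 ≤ m₀) where

  open Encoding Σ Pushes Pops m₀ N

  skip-final : ∀ α ws {s} → Idle s (final-unit (encode (α ∷ ws))) → Idle s (block₁ α (encode ws))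
  skip-final α ws i = i ∙ pop (body-pop m₀ (N ∷ []) 1≤m₀) (root (busy-own N))

  -- What follows the chosen unit depends on its position in the list. It is hidden as `k`, of which
  -- only the possibility of skipping it is retained.
  choose-push : ∀ {n α} K → n ∈ˡ Pushes α →
    ∃[ k ] ((∀ {s s₁} → Idle s (block₁ α K) → Busy (os n (base-string n k)) (𝐟 ∷ 𝐰 ∷ s₁) → Busy s s₁) ×
            (∀ {s} → Idle s k → Idle s (block₂ α K)))
  choose-push {n} {α} K n∈ with ∈-∃++ n∈
  ... | ns , ns′ , eq = push-units ns′ (block₂ α K) , (λ i b → next i chosen b) , skip-pushes ns′
    where
    eq′ : push-units (Pushes α) (block₂ α K) ≡ push-units ns (push-unit n (push-units ns′ (block₂ α K)))
    eq′ = trans (cong (λ ls → push-units ls (block₂ α K)) eq) (foldr-++ push-unit (block₂ α K) ns (n ∷ ns′))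
    chosen : Idle (base-string 0 (push-units (Pushes α) (block₂ α K))) (push-unit n (push-units ns′ (block₂ α K)))
    chosen = skip-pushes ns (subst (Idle _) eq′ (idle-base 0))

  choose-pop : ∀ {m ms α} K → (m , ms) ∈ˡ Pops α →
    ∃[ k ] ((∀ {s} → Idle s (block₂ α K) → Busy s (levels m ms (𝐪 ∷ k))) ×
            (∀ {s} → Idle s k → Idle s (block₃ K)))
  choose-pop {m} {ms} {α} K ν∈ with ∈-∃++ ν∈
  ... | νs , νs′ , eq = pop-units νs′ (block₃ K) , (λ i → first i chosen) , skip-pops νs′ (All.tail (++⁻ʳ νs positive′))
    where
    positive′ : All (λ ν → 1 ≤ proj₁ ν) (νs ++ (m , ms) ∷ νs′)
    positive′ = subst (All _) eq (first-positive α)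
    eq′ : pop-units (Pops α) (block₃ K) ≡ pop-units νs (pop-unit (m , ms) (pop-units νs′ (block₃ K)))
    eq′ = trans (cong (λ ls → pop-units ls (block₃ K)) eq) (foldr-++ pop-unit (block₃ K) νs ((m , ms) ∷ νs′))
    chosen : Idle (base-string 0 (pop-units (Pops α) (block₃ K))) (pop-unit (m , ms) (pop-units νs′ (block₃ K)))
    chosen = skip-pops νs (++⁻ˡ νs positive′) (subst (Idle _) eq′ (idle-base 0))

  -- The counter n pushed for α is reduced to v by matching the last j of its letters 𝐨 before the
  -- target is reached.
  record Reaches (v : ℕ) (α : Σ) (ws : List Σ) (target : List Letter) : Set where
    constructor reaches
    field
      n j  : ℕ
      n∈   : n ∈ˡ Pushes α
      n≡   : n ≡ v + j
      parse : ∀ k → (∀ {s} → Idle s k → Idle s (block₂ α (encode ws))) → Idle (os j (base-string n k)) target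

  -- The value is taken in front of `block₃`, before its subtraction of 1, so that `final-unit` can
  -- still be used there instead.
  Builds : ℕ → List Σ → List Σ → Set
  Builds v []       ws′ = ⊥
  Builds v (α ∷ ws) ws′ = Reaches v α ws (block₃ (encode ws′))

  reaches-skip : ∀ {v α ws ws′} → Reaches (suc v) α ws (block₃ (encode ws′)) → Reaches v α ws (final-unit (encode ws′))
  reaches-skip {v} (reaches n j n∈ n≡ i) =
    reaches n (suc j) n∈ (trans n≡ (sym (+-suc v j)))
      (λ k a → stop (unit (first (i k a) (idle-base 0))) here)

  -- A closing unit ahead, as seen by the counter under those still to be pushed: it enters the
  -- block idle and comes out facing the level `m`, everything above it having been popped.
  Pending : List Σ → ℕ × List ℕ → List Letter → Set
  Pending []       (m , ms) k = ⊥
  Pending (α ∷ ws) (m , ms) k = ∀ {s} → Idle s (block₁ α (encode ws)) → Busy s (levels m ms k)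

  builds-push : ∀ {v α ws} → suc v ∈ˡ Pushes α → (1 , []) ∈ˡ Pops α → Builds v (α ∷ ws) ws
  builds-push {v} {α} {ws} n∈ idle∈ with choose-pop (encode ws) idle∈
  ... | k₁ , first′ , absorb =
    reaches (suc v) 1 n∈ (+-comm 1 v) (λ k a → absorb (stop (unit (first′ (a (idle-base (suc v))))) here))

  pending-first : ∀ {α ws m ms} → 1 ∈ˡ Pushes α → (1 , m ∷ ms) ∈ˡ Pops α →
                  ∃[ k ] (Pending (α ∷ ws) (m , ms) (𝐪 ∷ k) × (∀ {s} → Idle s k → Idle s (block₃ (encode ws))))
  pending-first {α} {ws} 1∈ ν∈ with choose-push (encode ws) 1∈ | choose-pop (encode ws) ν∈
  ... | k , next′ , absorb | k₁ , first′ , absorb₁ =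
    k₁ , (λ i → next′ i (unit (first′ (absorb (idle-base 1))))) , absorb₁

  pending-step : ∀ {v ws ws₁ m ms k} → Builds (suc v) ws ws₁ → Pending ws₁ (v , m ∷ ms) k → Pending ws (m , ms) k
  pending-step {v} {α ∷ ws} {α₁ ∷ ws₁} {m} {ms} {k} b p i₀
    with reaches-skip {α = α} {ws} {α₁ ∷ ws₁} b
  ... | reaches n j n∈ refl i with choose-push (encode ws) n∈
  ... | k₂ , next′ , absorb = next′ i₀ (subst (λ s → Busy s _) (sym (os-+ v j _))
          (busy-units v (p (skip-final α₁ ws₁ (i k₂ absorb)))))

  -- The counter loses 1 in the `block₃` that precedes `ws₁`, and `r` as the last level of the
  -- closing unit.
  builds-close : ∀ {v r α ws ws₁ ws′ k} → Builds (suc (v + r)) (α ∷ ws) ws₁ → Pending ws₁ (r , []) (𝐪 ∷ k) →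
                 (∀ {s} → Idle s k → Idle s (block₃ (encode ws′))) → Builds v (α ∷ ws) ws′
  builds-close {v} {r} {α} {ws} {α₁ ∷ ws₁} {ws′} {k} b p absorb
    with reaches-skip {α = α} {ws} {α₁ ∷ ws₁} b
  ... | reaches n j n∈ n≡ i =
    reaches n (r + j) n∈ (trans n≡ (+-assoc v r j))
      (λ k₂ a → absorb (stop (subst (λ s → Busy s _) (sym (os-+ r j _))
        (busy-units r (p (skip-final α₁ ws₁ (i k₂ a))))) here))

  accept : ∀ {α ws} → Builds m₀ (α ∷ ws) [] → Busy (os N (base-string N (block₁ α (encode ws)))) []
  accept {α} {ws} (reaches n j n∈ refl i) with choose-push (encode ws) n∈
  ... | k , next′ , absorb =
    -- The initial counter keeps all its letters 𝐨 for the level `N` at the very end, and the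
    -- counter above it spends its last `m₀` on the level before.
    busy-units N (next′ (idle-base N)
      (subst (λ s → Busy s _) (sym (os-+ m₀ j _))
        (busy-units m₀ (first (i k absorb) (skip-pops idles (s≤s z≤n ∷ []) (idle-base 0))))))

-- Double Greibach normal form

record DoubleGreibach (Σ : Set) : Set₁ where
  field
    V Rule        : Set
    V-finite      : Finite V
    Rule-finite   : Finite Rule
    lhs           : Rule → V
    opening closing : Rule → Σ
    kids          : Rule → List V
    Valid         : Rule → Set
    valid?        : ∀ r → Dec (Valid r)
    Single        : V → Σ → Set
    single?       : ∀ A a → Dec (Single A a)
    start         : V

  mutual
    data Gen : V → List Σ → List Σ → Set where
      single : ∀ {A a w} → Single A a → Gen A (a ∷ w) w
      rule   : ∀ {w w₁} r → Valid r → Gens (kids r) w (closing r ∷ w₁) → Gen (lhs r) (opening r ∷ w) w₁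

    data Gens : List V → List Σ → List Σ → Set where
      []  : ∀ {w} → Gens [] w w
      _∷_ : ∀ {A As w w₁ w₂} → Gen A w w₁ → Gens As w₁ w₂ → Gens (A ∷ As) w w₂

-- Numbers for nonterminals and rules

module Coding {Σ : Set} (_≟_ : DecidableEquality Σ) (𝒢 : DoubleGreibach Σ) where

  open DoubleGreibach 𝒢

  -- Numbers of nonterminals are below M, and numbers of rules are multiples of M, at least M * κ and
  -- less than twice that: once a rule has been subtracted, no other can be.
  κ M N m₀ : ℕ
  κ = suc (card Rule-finite)
  M = suc (card V-finite)
  N = M * (κ + κ)

  ℓ : V → ℕ
  ℓ A = suc (index V-finite A)

  ρ : Rule → ℕ
  ρ r = M * (κ + index Rule-finite r)

  -- One more than `ℓ start`, because in the last block `final-unit` takes the place of the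
  -- subtraction of 1.
  m₀ = suc (ℓ start)

  -- The levels of a closing unit, beginning with the last of the children.
  prepend : List V → ℕ × List ℕ → ℕ × List ℕ
  prepend []       p        = p
  prepend (A ∷ As) (m , ms) = prepend As (ℓ A , m ∷ ms)

  -- Every block pushes a counter, also the block of a closing symbol; the first level 1 removes
  -- that counter.
  close : Rule → ℕ × List ℕ
  close r = 1 , proj₁ (prepend (kids r) (ρ r , [])) ∷ proj₂ (prepend (kids r) (ρ r , []))

  -- The constants compensate for the operations (1 , []) used in block₂ and block₃.
  single-push : V → ℕ
  single-push A = suc (suc (ℓ A))

  open-push : Rule → ℕ
  open-push r = suc (suc (suc (ℓ (lhs r) + ρ r)))

  Opens Closes : Σ → Rule → Set
  Opens a r  = Valid r × opening r ≡ a
  Closes a r = Valid r × closing r ≡ a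

  opens? : ∀ a r → Dec (Opens a r)
  opens? a r = valid? r ×-dec (opening r ≟ a)

  closes? : ∀ a r → Dec (Closes a r)
  closes? a r = valid? r ×-dec (closing r ≟ a)

  single-pushes open-pushes : Σ → List ℕ
  single-pushes a = map single-push (filter (λ A → single? A a) (elements V-finite))
  open-pushes a   = map open-push (filter (opens? a) (elements Rule-finite))

  -- The counter 1 is pushed for a closing symbol: it must be popped in the same block, because it
  -- cannot survive subtracting 1 twice.
  Pushes : Σ → List ℕ
  Pushes a = 1 ∷ single-pushes a ++ open-pushes a

  Pops : Σ → List (ℕ × List ℕ)
  Pops a = (1 , []) ∷ map close (filter (closes? a) (elements Rule-finite))

  data Push (a : Σ) : ℕ → Set where
    one    : Push a 1
    single : ∀ A → Single A a → Push a (single-push A)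
    opens  : ∀ r → Opens a r → Push a (open-push r)

  push-view : ∀ {a n} → n ∈ˡ Pushes a → Push a n
  push-view (here refl) = one
  push-view {a} (there n∈) with ∈-++⁻ (single-pushes a) n∈
  ... | inj₁ n∈₁ with ∈-map⁻ single-push n∈₁
  ...   | A , A∈ , refl = single A (proj₂ (∈-filter⁻ (λ A → single? A a) {xs = elements V-finite} A∈))
  push-view {a} (there n∈) | inj₂ n∈₂ with ∈-map⁻ open-push n∈₂
  ...   | r , r∈ , refl = opens r (proj₂ (∈-filter⁻ (opens? a) {xs = elements Rule-finite} r∈))

  single-∈ : ∀ {a A} → Single A a → single-push A ∈ˡ Pushes a
  single-∈ {a} {A} s =
    there (∈-++⁺ˡ (∈-map⁺ single-push (∈-filter⁺ (λ A → single? A a) (∈-elements V-finite A) s)))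

  open-∈ : ∀ {r} → Valid r → open-push r ∈ˡ Pushes (opening r)
  open-∈ {r} v = there (∈-++⁺ʳ (single-pushes (opening r))
    (∈-map⁺ open-push (∈-filter⁺ (opens? (opening r)) (∈-elements Rule-finite r) (v , refl))))

  close-∈ : ∀ {r} → Valid r → close r ∈ˡ Pops (closing r)
  close-∈ {r} v = there (∈-map⁺ close (∈-filter⁺ (closes? (closing r)) (∈-elements Rule-finite r) (v , refl)))

  data Pop (a : Σ) : ℕ × List ℕ → Set where
    one    : Pop a (1 , [])
    closes : ∀ r → Closes a r → Pop a (close r)

  pop-view : ∀ {a ν} → ν ∈ˡ Pops a → Pop a ν
  pop-view (here refl) = one
  pop-view {a} (there ν∈) with ∈-map⁻ close ν∈
  ... | r , r∈ , refl = closes r (proj₂ (∈-filter⁻ (closes? a) {xs = elements Rule-finite} r∈))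

  first-positive : ∀ a → All (λ ν → 1 ≤ proj₁ ν) (Pops a)
  first-positive a = All.tabulate λ ν∈ → positive′ (pop-view ν∈)
    where
    positive′ : ∀ {ν} → Pop a ν → 1 ≤ proj₁ ν
    positive′ one          = s≤s z≤n
    positive′ (closes r _) = s≤s z≤n

  open Encoding Σ Pushes Pops m₀ N public
  open Building Σ Pushes Pops m₀ N first-positive (s≤s z≤n)

  M≤ρ : ∀ r → M * κ ≤ ρ r
  M≤ρ r = *-monoʳ-≤ M (m≤m+n κ (index Rule-finite r))

  M≤Mκ : M ≤ M * κ
  M≤Mκ = m≤m*n M κ

  1≤ρ : ∀ r → 1 ≤ ρ r
  1≤ρ r = ≤-trans (s≤s z≤n) (≤-trans M≤Mκ (M≤ρ r))

  1≤N : 1 ≤ N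
  1≤N = ≤-trans (≤-trans (s≤s z≤n) M≤Mκ) (*-monoʳ-≤ M (m≤m+n κ κ))

  ℓ<M : ∀ A → ℓ A < M
  ℓ<M A = s≤s (index<card V-finite A)

  ℓ-injective : ∀ {A B} → ℓ A ≡ ℓ B → A ≡ B
  ℓ-injective eq = index-injective V-finite (suc-injective eq)

  prepend-positive : ∀ As {m ms} → Positive m ms → let p = prepend As (m , ms) in Positive (proj₁ p) (proj₂ p)
  prepend-positive []       p = p
  prepend-positive (A ∷ As) p = prepend-positive As p

  positive : ∀ {a m ms} → (m , ms) ∈ˡ Pops a → Positive m ms
  positive ν∈ = view (pop-view ν∈)
    where
    view : ∀ {a ν} → Pop a ν → Positive (proj₁ ν) (proj₂ ν)
    view one          = s≤s z≤n
    view (closes r _) = prepend-positive (kids r) (1≤ρ r)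

  open Parsing positive 1≤N using (accepted)

  mutual
    builds : ∀ {A w w′} → Gen A w w′ → Builds (suc (ℓ A)) w w′
    builds (single s)     = builds-push (single-∈ s) (here refl)
    builds (rule {w} {w₁} r v ks) with pending-first {ws = w₁} (here refl) (close-∈ v)
    ... | k , p , absorb =
      builds-close {r = ρ r} {ws′ = w₁} (builds-push {ws = w} (open-∈ v) (here refl)) (pending ks p) absorb

    pending : ∀ {As w w₁ m ms k} → Gens As w w₁ → Pending w₁ (prepend As (m , ms)) k → Pending w (m , ms) k
    pending []                 p = p
    pending (_∷_ {w = w} g gs) p = pending-step {ws = w} (builds g) (pending gs p)

  -- A counter is complete, waits for its closing symbol, or has been closed by a wrong rule;
  -- in the last case it is never popped.
  data Class (v : ℕ) (w w′ : List Σ) : Set where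
    done : ∀ A → v ≡ ℓ A → Gen A w w′ → Class v w w′
    wait : ∀ r → v ≡ suc (ℓ (lhs r) + ρ r) → Valid r → w ≡ opening r ∷ w′ → Class v w w′
    dead : M ≤ v → v < M * κ → Class v w w′

  -- The classification in front of `block₃`: the value 0 cannot survive the subtraction there, and
  -- any other value is classified by its predecessor.
  Class′ : ℕ → List Σ → List Σ → Set
  Class′ v w w′ = v ≡ 0 ⊎ ∃[ v′ ] (v ≡ suc v′ × Class v′ w w′)

  -- This is what rules out `exit` for pushed counters.
  class<N : ∀ {v w w′} → Class v w w′ → v < N
  class<N (done A refl _)   = ≤-trans (ℓ<M A) (≤-trans M≤Mκ (*-monoʳ-≤ M (m≤m+n κ κ)))
  class<N (wait r refl _ _) = begin-strict
    suc (ℓ (lhs r) + ρ r)                        ≤⟨ +-monoˡ-≤ (ρ r) (ℓ<M (lhs r)) ⟩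
    M + M * (κ + index Rule-finite r)            ≡⟨ *-suc M (κ + index Rule-finite r) ⟨
    M * suc (κ + index Rule-finite r)            <⟨ *-monoʳ-< M suc<κ+κ ⟩
    M * (κ + κ)                                  ∎
    where
    open ≤-Reasoning
    suc<κ+κ : suc (κ + index Rule-finite r) < κ + κ
    suc<κ+κ = ≤-trans (s≤s (≤-reflexive (sym (+-suc κ _)))) (+-monoʳ-< κ (s≤s (index<card Rule-finite r)))
  class<N (dead _ v<)       = ≤-trans v< (*-monoʳ-≤ M (m≤m+n κ κ))

  class-ℓ : ∀ {A w w′} → Class (ℓ A) w w′ → Gen A w w′
  class-ℓ (done B eq g) with refl ← ℓ-injective eq = g
  class-ℓ {A} (wait r eq _ _) = ⊥-elim (<⇒≱ (ℓ<M A) (begin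
    M                     ≤⟨ ≤-trans M≤Mκ (M≤ρ r) ⟩
    ρ r                   ≤⟨ m≤n+m (ρ r) (suc (ℓ (lhs r))) ⟩
    suc (ℓ (lhs r) + ρ r) ≡⟨ eq ⟨
    ℓ A                   ∎))
    where open ≤-Reasoning
  class-ℓ {A} (dead M≤ _) = ⊥-elim (<⇒≱ (ℓ<M A) M≤)

  -- Complete and dead counters are below every `ρ r`. A waiting counter may be hit by a rule other
  -- than its own, and three cases arise from comparing the two numbers.
  class-subtract : ∀ r {a d w w₁ w₂} → Closes a r → Class (ρ r + d) w w₁ → Gens (kids r) w₁ (a ∷ w₂) → Class′ d w w₂
  class-subtract r {d = d} c (done A eq _) ks = ⊥-elim (<⇒≱ (ℓ<M A) (begin
    M       ≤⟨ ≤-trans M≤Mκ (M≤ρ r) ⟩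
    ρ r     ≤⟨ m≤m+n (ρ r) d ⟩
    ρ r + d ≡⟨ eq ⟩
    ℓ A     ∎))
    where open ≤-Reasoning
  class-subtract r {d = d} c (dead _ v<) ks =
    ⊥-elim (<⇒≱ v< (≤-trans (M≤ρ r) (m≤m+n (ρ r) d)))
  class-subtract r {d = d} (v , refl) (wait r′ eq v′ refl) ks
    with <-cmp (index Rule-finite r′) (index Rule-finite r)
  -- The rest is at most 0, since numbers of distinct rules differ by at least `M` and a nonterminal
  -- adds less than that.
  ... | tri< i′<i _ _ = inj₁ (m+n≤m⇒n≡0 (ρ r) (begin
    ρ r + d                                ≡⟨ eq ⟩
    suc (ℓ (lhs r′)) + ρ r′                ≤⟨ +-monoˡ-≤ (ρ r′) (ℓ<M (lhs r′)) ⟩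
    M + M * (κ + index Rule-finite r′)     ≡⟨ *-suc M (κ + index Rule-finite r′) ⟨
    M * suc (κ + index Rule-finite r′)     ≤⟨ *-monoʳ-≤ M (+-monoʳ-< κ i′<i) ⟩
    ρ r                                    ∎))
    where
    open ≤-Reasoning
    m+n≤m⇒n≡0 : ∀ m {n} → m + n ≤ m → n ≡ 0
    m+n≤m⇒n≡0 m {n} le = n≤0⇒n≡0 (+-cancelˡ-≤ m n 0 (≤-trans le (≤-reflexive (sym (+-identityʳ m)))))
  ... | tri≈ _ i≡ _ with refl ← index-injective Rule-finite i≡ =
    inj₂ (ℓ (lhs r) , +-cancelˡ-≡ (ρ r) d _ (trans eq (+-comm (suc (ℓ (lhs r))) (ρ r))) ,
          done (lhs r) refl (rule r v ks))
  -- The rest contains a positive multiple of `M`: too large for a nonterminal, and too small to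
  -- subtract any rule again.
  ... | tri> _ _ i<i′ = inj₂ (ℓ (lhs r′) + M * suc δ , d≡ , dead M≤v v<Mκ)
    where
    open ≤-Reasoning
    i i′ δ : ℕ
    i  = index Rule-finite r
    i′ = index Rule-finite r′
    δ  = i′ ∸ suc i
    i′≡ : i′ ≡ i + suc δ
    i′≡ = trans (sym (m+[n∸m]≡n i<i′)) (sym (+-suc i δ))
    δ<card : δ < card Rule-finite
    δ<card = ≤-trans (m≤n+m (suc δ) i) (≤-trans (≤-reflexive (sym i′≡)) (<⇒≤ (index<card Rule-finite r′)))
    ρ′≡ : ρ r′ ≡ ρ r + M * suc δ
    ρ′≡ = trans (cong (λ k → M * (κ + k)) i′≡)
      (trans (cong (M *_) (sym (+-assoc κ i (suc δ)))) (*-distribˡ-+ M (κ + i) (suc δ)))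
    d≡ : d ≡ suc (ℓ (lhs r′) + M * suc δ)
    d≡ = +-cancelˡ-≡ (ρ r) d _ (begin-equality
      ρ r + d                                      ≡⟨ eq ⟩
      suc (ℓ (lhs r′)) + ρ r′                      ≡⟨ cong (suc (ℓ (lhs r′)) +_) ρ′≡ ⟩
      suc (ℓ (lhs r′)) + (ρ r + M * suc δ)         ≡⟨ +-assoc (suc (ℓ (lhs r′))) (ρ r) _ ⟨
      suc (ℓ (lhs r′)) + ρ r + M * suc δ           ≡⟨ cong (_+ M * suc δ) (+-comm (suc (ℓ (lhs r′))) (ρ r)) ⟩
      ρ r + suc (ℓ (lhs r′)) + M * suc δ           ≡⟨ +-assoc (ρ r) _ _ ⟩
      ρ r + suc (ℓ (lhs r′) + M * suc δ)           ∎)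
    M≤v : M ≤ ℓ (lhs r′) + M * suc δ
    M≤v = ≤-trans (m≤m*n M (suc δ)) (m≤n+m _ (ℓ (lhs r′)))
    v<Mκ : ℓ (lhs r′) + M * suc δ < M * κ
    v<Mκ = begin-strict
      ℓ (lhs r′) + M * suc δ <⟨ +-monoˡ-< (M * suc δ) (ℓ<M (lhs r′)) ⟩
      M + M * suc δ          ≡⟨ *-suc M (suc δ) ⟨
      M * suc (suc δ)        ≤⟨ *-monoʳ-≤ M (s≤s δ<card) ⟩
      M * κ                  ∎

  class-push : ∀ {a d w} → Push a (suc d) → Class′ d (a ∷ w) w
  class-push one                  = inj₁ refl
  class-push (single A s)         = inj₂ (ℓ A , refl , done A refl (single s))
  class-push (opens r (v , refl)) = inj₂ (suc (ℓ (lhs r) + ρ r) , refl , wait r refl v refl)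

  prepend-∷ʳ : ∀ As A p → prepend (As ∷ʳ A) p ≡ (ℓ A , proj₁ (prepend As p) ∷ proj₂ (prepend As p))
  prepend-∷ʳ []       A p = refl
  prepend-∷ʳ (B ∷ As) A p = prepend-∷ʳ As A _

  -- A closing unit in progress: the children in `right` have been popped, and those in `left`
  -- remain as levels. Popping moves the last element of `left` to `right`.
  record Closing (a : Σ) (ν : ℕ × List ℕ) (w w₁ : List Σ) : Set where
    constructor popped
    field
      r           : Rule
      closes-r    : Closes a r
      left right  : List V
      kids≡       : kids r ≡ left ++ right
      levels≡     : ν ≡ prepend left (ρ r , [])
      gens        : Gens right w (a ∷ w₁)

  mutual
    class : ∀ {v w w′} → Counter pushed v w w′ → Class v w w′
    class (skip a) with class′ a
    ... | inj₁ ()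
    ... | inj₂ (_ , refl , c) = c
    class {v} (exit _ c) = ⊥-elim (<⇒≱ (class<N (class c)) (m≤m+n N v))

    class′ : ∀ {v w w′} → After pushed v w w′ → Class′ v w w′
    class′ (subtract (top ν∈ n∈)) = fresh (pop-view ν∈) (push-view n∈)
      where
      fresh : ∀ {a m d w} → Pop a (m , []) → Push a (m + d) → Class′ d (a ∷ w) w
      fresh one p = class-push p
    class′ (subtract (below p c)) with class-pop p
    ... | popped r cl left right kids≡ levels≡ gens with initLast left
    ... | [] with refl ← levels≡ = class-subtract r cl (class c) (subst (λ As → Gens As _ _) (sym kids≡) gens)
    ... | As ∷ʳ′ A with () ← trans levels≡ (prepend-∷ʳ As A _)

    class-pop : ∀ {a m m′ ms w w₁} → Popping pushed a w₁ m (m′ ∷ ms) m w → Closing a (m′ , ms) w w₁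
    class-pop (top ν∈ _) = fresh (pop-view ν∈)
      where
      fresh : ∀ {a m m′ ms w₁} → Pop a (m , m′ ∷ ms) → Closing a (m′ , ms) (a ∷ w₁) w₁
      fresh (closes r cl) = popped r cl (kids r) [] (sym (++-identityʳ (kids r))) refl []
    class-pop (below p c) with class-pop p
    ... | popped r cl left right kids≡ levels≡ gens with initLast left
    ... | [] with () ← levels≡
    ... | As ∷ʳ′ A with refl ← trans levels≡ (prepend-∷ʳ As A _) =
      popped r cl As (A ∷ right) (trans kids≡ (++-assoc As [ A ] right)) refl (class-ℓ (class c) ∷ gens)

  -- An initial counter only loses value, and loses some as soon as it is used. The final test
  -- against `N` thus shows that the counter above it was created at the first symbol and spans the
  -- whole word.
  rooted-bound : ∀ {v w w′} → Counter rooted v w w′ → (v ≡ N × w ≡ w′) ⊎ v < N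
  rooted-bound created  = inj₁ (refl , refl)
  rooted-bound (skip a) = inj₂ (after-bound a)
    where
    after-bound : ∀ {v w w′} → After rooted v w w′ → v ≤ N
    after-bound (subtract {m = m} {d = d} (below _ c)) with rooted-bound c
    ... | inj₁ (eq , _) = ≤-trans (m≤n+m d m) (≤-reflexive eq)
    ... | inj₂ lt       = ≤-trans (m≤n+m d m) (<⇒≤ lt)
  rooted-bound {v} (exit _ c) with rooted-bound c
  ... | inj₁ (eq , _) = inj₂ (≤-trans (s≤s (≤-reflexive (m+n≡m⇒n≡0 N eq))) 1≤N)
    where
    m+n≡m⇒n≡0 : ∀ m {n} → m + n ≡ m → n ≡ 0
    m+n≡m⇒n≡0 m {n} eq = +-cancelˡ-≡ m n 0 (trans eq (sym (+-identityʳ m)))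
  ... | inj₂ lt = ⊥-elim (<⇒≱ lt (m≤m+n N v))

  generated : ∀ {a w} → Busy (os N (base-string N (block₁ a (encode w)))) [] → Gen start (a ∷ w) []
  generated b with accepted _ _ b
  ... | w₁ , after , counter with rooted-bound counter
  ... | inj₂ lt = ⊥-elim (<-irrefl refl lt)
  ... | inj₁ (_ , refl) with class′ after
  ... | inj₂ (_ , refl , c) = class-ℓ c

  encoded : ∀ {a w} → Gen start (a ∷ w) [] → Busy (os N (base-string N (block₁ a (encode w)))) []
  encoded g = accept (builds g)

  recognised : ∀ w → w ≢ [] → Gen start w [] ⇔ CategorialGrammar.language grammar (homomorphism hom w)
  recognised []      w≢[] = ⊥-elim (w≢[] refl)
  recognised (a ∷ w) _    = mk⇔
    (λ g → subst (CategorialGrammar.language grammar) (sym (homomorphism≡encode (a ∷ w))) (busy⇒language (encoded g)))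
    accepted⇒gen
    where
    accepted⇒gen : CategorialGrammar.language grammar (homomorphism hom (a ∷ w)) → Gen start (a ∷ w) []
    accepted⇒gen w∈ with language⇒busy (subst (CategorialGrammar.language grammar) (homomorphism≡encode (a ∷ w)) w∈)
    ... | _ , refl , b = generated b

-- Equality and closure properties of finite types

≟-finite : ∀ {A} → Finite A → DecidableEquality A
≟-finite fin a b = map′ (index-injective fin) (cong (index fin)) (index fin a ℕ.≟ index fin b)

finite-Fin : ∀ n → Finite (Fin n)
finite-Fin n = n , ↔-id (Fin n)

finite-× : ∀ {A B} → Finite A → Finite B → Finite (A × B)
finite-× (m , f) (n , g) = _ , ↔-sym (*↔× {m} {n}) ↔-∘ (f ×-↔ g)

finite-Maybe : ∀ {A} → Finite A → Finite (Maybe A)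
finite-Maybe {A} (n , f) = suc n , mk↔ₛ′ to′ from′ to∘from from∘to
  where
  open Inverse f
  to′ : Maybe A → Fin (suc n)
  to′ nothing  = zero
  to′ (just a) = suc (to a)
  from′ : Fin (suc n) → Maybe A
  from′ zero    = nothing
  from′ (suc i) = just (from i)
  to∘from : ∀ i → to′ (from′ i) ≡ i
  to∘from zero    = refl
  to∘from (suc i) = cong suc (strictlyInverseˡ i)
  from∘to : ∀ m → from′ (to′ m) ≡ m
  from∘to nothing  = refl
  from∘to (just a) = cong just (strictlyInverseʳ a)

-- From Chomsky normal form to double Greibach normal form

record Chomsky (Σ : Set) : Set₁ where
  field
    size    : ℕ
    Leaf    : Fin size → Σ → Set
    Node    : Fin size → Fin size → Fin size → Set
    leaf?   : ∀ A a → Dec (Leaf A a)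
    node?   : ∀ A B C → Dec (Node A B C)
    start   : Fin size

  data Tree : Fin size → List Σ → List Σ → Set where
    leaf : ∀ {A a w} → Leaf A a → Tree A (a ∷ w) w
    node : ∀ {A B C w w₁ w₂} → Node A B C → Tree B w w₁ → Tree C w₁ w₂ → Tree A w w₂

module Spines {Σ : Set} (Σ-finite : Finite Σ) (𝒞 : Chomsky Σ) where

  open Chomsky 𝒞

  I : Set
  I = Fin size

  -- The subtrees hanging to the right (left) of a nonempty path from the first nonterminal to the second,
  -- which follows left (right) children.
  data Left : I → I → List Σ → List Σ → Set where
    one  : ∀ {X Y C w w₁} → Node X Y C → Tree C w w₁ → Left X Y w w₁
    more : ∀ {X X′ Y C w w₁ w₂} → Node X X′ C → Left X′ Y w w₁ → Tree C w₁ w₂ → Left X Y w w₂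

  data Right : I → I → List Σ → List Σ → Set where
    one  : ∀ {X Y C w w₁} → Node X C Y → Tree C w w₁ → Right X Y w w₁
    more : ∀ {X X′ Y C w w₁ w₂} → Node X C X′ → Tree C w w₁ → Right X′ Y w₁ w₂ → Right X Y w w₂

  data Shape : Set where
    word left right : Shape

  finite-Shape : Finite Shape
  finite-Shape = finite-listed (word ∷ left ∷ right ∷ [])
    λ { word → here refl ; left → there (here refl) ; right → there (there (here refl)) }

  -- The last component is ignored in a label of shape word.
  Label : Set
  Label = Shape × I × I

  finite-Label : Finite Label
  finite-Label = finite-× finite-Shape (finite-× (finite-Fin size) (finite-Fin size))

  ⟦_⟧ : Label → List Σ → List Σ → Set
  ⟦ word , X , _ ⟧  = Tree X
  ⟦ left , X , Y ⟧  = Left X Y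
  ⟦ right , X , Y ⟧ = Right X Y

  ⟦_⟧? : Maybe Label → List Σ → List Σ → Set
  ⟦ nothing ⟧? w w₁ = w ≡ w₁
  ⟦ just L ⟧?  w w₁ = ⟦ L ⟧ w w₁

  LeftTo RightTo : I → I → Maybe Label → Set
  LeftTo X Y nothing   = X ≡ Y
  LeftTo X Y (just L)  = L ≡ (left , X , Y)
  RightTo X Y nothing  = X ≡ Y
  RightTo X Y (just L) = L ≡ (right , X , Y)

  -- A label denotes a nonempty sequence of trees, which has one element, or else has a first
  -- element, a middle part and a last element.
  One : Label → I → Set
  One (word , X , _)  Z = Z ≡ X
  One (left , X , Y)  Z = Node X Y Z
  One (right , X , Y) Z = Node X Z Y

  Two : Label → I → Maybe Label → I → Set
  Two (word , _)      C m D = ⊥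
  Two (left , X , Y)  C m D = ∃[ E ] ∃[ X′ ] (Node E Y C × LeftTo X′ E m × Node X X′ D)
  Two (right , X , Y) C m D = ∃[ X′ ] ∃[ E ] (Node X C X′ × RightTo X′ E m × Node E D Y)

  Ends : Label → I → Maybe Label → I → Set
  Ends L C m D = (∃[ Z ] (One L Z × m ≡ nothing × Node Z C D)) ⊎ Two L C m D

  leftTo? : ∀ X Y m → Dec (LeftTo X Y m)
  leftTo? X Y nothing  = X ≟ᶠ Y
  leftTo? X Y (just L) = ≟-finite finite-Label L (left , X , Y)

  rightTo? : ∀ X Y m → Dec (RightTo X Y m)
  rightTo? X Y nothing  = X ≟ᶠ Y
  rightTo? X Y (just L) = ≟-finite finite-Label L (right , X , Y)

  one? : ∀ L Z → Dec (One L Z)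
  one? (word , X , _)  Z = Z ≟ᶠ X
  one? (left , X , Y)  Z = node? X Y Z
  one? (right , X , Y) Z = node? X Z Y

  two? : ∀ L C m D → Dec (Two L C m D)
  two? (word , _)      C m D = no λ ()
  two? (left , X , Y)  C m D = any? λ E → any? λ X′ → node? E Y C ×-dec leftTo? X′ E m ×-dec node? X X′ D
  two? (right , X , Y) C m D = any? λ X′ → any? λ E → node? X C X′ ×-dec rightTo? X′ E m ×-dec node? E D Y

  ends? : ∀ L C m D → Dec (Ends L C m D)
  ends? L C m D =
    (any? λ Z → one? L Z ×-dec Maybe.≡-dec (≟-finite finite-Label) m nothing ×-dec node? Z C D)
    ⊎-dec two? L C m D

  -- A terminal, the root of the first or last tree, the end of its outer branch, and the label of
  -- what hangs off this branch, if anything does.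
  Side : Set
  Side = Σ × I × I × Maybe Label

  finite-Side : Finite Side
  finite-Side = finite-× Σ-finite (finite-× (finite-Fin size) (finite-× (finite-Fin size) (finite-Maybe finite-Label)))

  Valid : Label × Maybe Label × Side × Side → Set
  Valid (L , m , (a , C , A , mₗ) , (b , D , B , mᵣ)) =
    Ends L C m D × (LeftTo C A mₗ × Leaf A a) × (RightTo D B mᵣ × Leaf B b)

  kids : Label × Maybe Label × Side × Side → List Label
  kids (_ , m , (_ , _ , _ , mₗ) , (_ , _ , _ , mᵣ)) = catMaybes (mₗ ∷ m ∷ mᵣ ∷ [])

  double-greibach : DoubleGreibach Σ
  double-greibach = record
    { V           = Label
    ; Rule        = Label × Maybe Label × Side × Side
    ; V-finite    = finite-Label
    ; Rule-finite = finite-× finite-Label (finite-× (finite-Maybe finite-Label) (finite-× finite-Side finite-Side))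
    ; lhs         = proj₁
    ; opening     = λ (_ , _ , (a , _) , _) → a
    ; closing     = λ (_ , _ , _ , (b , _)) → b
    ; kids        = kids
    ; Valid       = Valid
    ; valid?      = λ (L , m , (a , C , A , mₗ) , (b , D , B , mᵣ)) →
        ends? L C m D ×-dec (leftTo? C A mₗ ×-dec leaf? A a) ×-dec (rightTo? D B mᵣ ×-dec leaf? B b)
    ; Single      = λ L a → ∃[ Z ] (One L Z × Leaf Z a)
    ; single?     = λ L a → any? λ Z → one? L Z ×-dec leaf? Z a
    ; start       = word , start , start
    }

  open DoubleGreibach double-greibach using (Gen; Gens; single; rule; []; _∷_)

  one-sound : ∀ L {Z w w₁} → One L Z → Tree Z w w₁ → ⟦ L ⟧ w w₁
  one-sound (word , _)  refl t = t
  one-sound (left , _)  n    t = one n t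
  one-sound (right , _) n    t = one n t

  left-tree : ∀ {X Y w w₁ w₂} → Tree Y w w₁ → Left X Y w₁ w₂ → Tree X w w₂
  left-tree t (one n t₁)    = node n t t₁
  left-tree t (more n l t₁) = node n (left-tree t l) t₁

  right-tree : ∀ {X Y w w₁ w₂} → Right X Y w w₁ → Tree Y w₁ w₂ → Tree X w w₂
  right-tree (one n t₁)    t = node n t₁ t
  right-tree (more n t₁ r) t = node n t₁ (right-tree r t)

  leftTo-tree : ∀ {X Y} m {w w₁ w₂} → LeftTo X Y m → Tree Y w w₁ → ⟦ m ⟧? w₁ w₂ → Tree X w w₂
  leftTo-tree nothing  refl t refl = t
  leftTo-tree (just _) refl t l    = left-tree t l

  rightTo-tree : ∀ {X Y} m {w w₁ w₂} → RightTo X Y m → ⟦ m ⟧? w w₁ → Tree Y w₁ w₂ → Tree X w w₂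
  rightTo-tree nothing  refl refl t = t
  rightTo-tree (just _) refl r    t = right-tree r t

  left-snoc : ∀ {X E Y C w w₁ w₂} → Node E Y C → Tree C w w₁ → Left X E w₁ w₂ → Left X Y w w₂
  left-snoc n t (one n₁ t₁)    = more n₁ (one n t) t₁
  left-snoc n t (more n₁ l t₁) = more n₁ (left-snoc n t l) t₁

  right-snoc : ∀ {X E Y C w w₁ w₂} → Right X E w w₁ → Node E C Y → Tree C w₁ w₂ → Right X Y w w₂
  right-snoc (one n₁ t₁)    n t = more n₁ t₁ (one n t)
  right-snoc (more n₁ t₁ r) n t = more n₁ t₁ (right-snoc r n t)

  ends-sound : ∀ L {C D} m {w w₁ w₂ w₃} → Ends L C m D → Tree C w w₁ → ⟦ m ⟧? w₁ w₂ → Tree D w₂ w₃ → ⟦ L ⟧ w w₃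
  ends-sound L _ (inj₁ (_ , o , refl , n)) t refl t₁ = one-sound L o (node n t t₁)
  ends-sound (left , _)  nothing  (inj₂ (_ , _ , n , refl , n₁)) t refl t₁ = more n₁ (one n t) t₁
  ends-sound (left , _)  (just _) (inj₂ (_ , _ , n , refl , n₁)) t l    t₁ = more n₁ (left-snoc n t l) t₁
  ends-sound (right , _) nothing  (inj₂ (_ , _ , n , refl , n₁)) t refl t₁ = more n t (one n₁ t₁)
  ends-sound (right , _) (just _) (inj₂ (_ , _ , n , refl , n₁)) t r    t₁ = more n t (right-snoc r n₁ t₁)

  Sequence : List (Maybe Label) → List Σ → List Σ → Set
  Sequence []       w w₁ = w ≡ w₁
  Sequence (m ∷ ms) w w₁ = ∃[ w₂ ] (⟦ m ⟧? w w₂ × Sequence ms w₂ w₁)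

  mutual
    sound : ∀ {L w w₁} → Gen L w w₁ → ⟦ L ⟧ w w₁
    sound {L} (single (_ , o , l)) = one-sound L o (leaf l)
    sound (rule (L , m , (a , C , A , mₗ) , (b , D , B , mᵣ)) (e , (p , l) , (q , l₁)) gs)
      with sound? (mₗ ∷ m ∷ mᵣ ∷ []) gs
    ... | _ , s , _ , s₁ , _ , s₂ , refl =
      ends-sound L m e (leftTo-tree mₗ p (leaf l) s) s₁ (rightTo-tree mᵣ q s₂ (leaf l₁))

    sound? : ∀ ms {w w₁} → Gens (catMaybes ms) w w₁ → Sequence ms w w₁
    sound? []             []       = refl
    sound? (nothing ∷ ms) gs       = _ , refl , sound? ms gs
    sound? (just L ∷ ms)  (g ∷ gs) = _ , sound g , sound? ms gs

  tree-length : ∀ {A w w₁} → Tree A w w₁ → length w₁ < length w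
  tree-length (leaf _)      = n<1+n _
  tree-length (node _ t t₁) = <-trans (tree-length t₁) (tree-length t)

  left-length : ∀ {X Y w w₁} → Left X Y w w₁ → length w₁ < length w
  left-length (one _ t)    = tree-length t
  left-length (more _ l t) = <-trans (tree-length t) (left-length l)

  right-length : ∀ {X Y w w₁} → Right X Y w w₁ → length w₁ < length w
  right-length (one _ t)    = tree-length t
  right-length (more _ t r) = <-trans (right-length r) (tree-length t)

  maybe-length : ∀ m {w w₁} → ⟦ m ⟧? w w₁ → length w₁ ≤ length w
  maybe-length nothing                refl = ≤-refl
  maybe-length (just (word , _ , _))  t    = <⇒≤ (tree-length t)
  maybe-length (just (left , _ , _))  l    = <⇒≤ (left-length l)
  maybe-length (just (right , _ , _)) r    = <⇒≤ (right-length r)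

  left-spine : ∀ {X w w₁} → Tree X w w₁ →
    ∃[ A ] ∃[ a ] ∃[ m ] ∃[ w₂ ] (w ≡ a ∷ w₂ × LeftTo X A m × Leaf A a × ⟦ m ⟧? w₂ w₁)
  left-spine (leaf l) = _ , _ , nothing , _ , refl , refl , l , refl
  left-spine (node n t t₁) with left-spine t
  ... | _ , _ , nothing  , _ , refl , refl , l , refl = _ , _ , just _ , _ , refl , refl , l , one n t₁
  ... | _ , _ , just _   , _ , refl , refl , l , p    = _ , _ , just _ , _ , refl , refl , l , more n p t₁

  right-spine : ∀ {X w w₁} → Tree X w w₁ →
    ∃[ A ] ∃[ a ] ∃[ m ] (RightTo X A m × Leaf A a × ⟦ m ⟧? w (a ∷ w₁))
  right-spine (leaf l) = _ , _ , nothing , refl , l , refl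
  right-spine (node n t t₁) with right-spine t₁
  ... | _ , _ , nothing , refl , l , refl = _ , _ , just _ , refl , l , one n t
  ... | _ , _ , just _  , refl , l , p    = _ , _ , just _ , refl , l , more n t p

  -- Deeper subtrees of a left branch stand further to the left, so the first tree of the sequence
  -- is at the bottom. On a right branch the bottom one is the last.
  left-bottom : ∀ {X Y w w₁} → Left X Y w w₁ →
    ∃[ E ] ∃[ C ] ∃[ m ] ∃[ w₂ ] (Node E Y C × Tree C w w₂ × LeftTo X E m × ⟦ m ⟧? w₂ w₁)
  left-bottom (one n t) = _ , _ , nothing , _ , n , t , refl , refl
  left-bottom (more n l t) with left-bottom l
  ... | _ , _ , nothing , _ , n₁ , t₁ , refl , refl = _ , _ , just _ , _ , n₁ , t₁ , refl , one n t
  ... | _ , _ , just _  , _ , n₁ , t₁ , refl , p    = _ , _ , just _ , _ , n₁ , t₁ , refl , more n p t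

  right-bottom : ∀ {X Y w w₁} → Right X Y w w₁ →
    ∃[ E ] ∃[ C ] ∃[ m ] ∃[ w₂ ] (Node E C Y × Tree C w₂ w₁ × RightTo X E m × ⟦ m ⟧? w w₂)
  right-bottom (one n t) = _ , _ , nothing , _ , n , t , refl , refl
  right-bottom (more n t r) with right-bottom r
  ... | _ , _ , nothing , _ , n₁ , t₁ , refl , refl = _ , _ , just _ , _ , n₁ , t₁ , refl , one n t
  ... | _ , _ , just _  , _ , n₁ , t₁ , refl , p    = _ , _ , just _ , _ , n₁ , t₁ , refl , more n t p

  data Split (L : Label) (w w₁ : List Σ) : Set where
    leaf : ∀ Z a → One L Z → Leaf Z a → w ≡ a ∷ w₁ → Split L w w₁
    ends : ∀ C m D {w₂ w₃} → Ends L C m D → Tree C w w₂ → ⟦ m ⟧? w₂ w₃ → Tree D w₃ w₁ → Split L w w₁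

  split-one : ∀ L {Z w w₁} → One L Z → Tree Z w w₁ → Split L w w₁
  split-one L o (leaf l)      = leaf _ _ o l refl
  split-one L o (node n t t₁) = ends _ nothing _ (inj₁ (_ , o , refl , n)) t refl t₁

  split : ∀ L {w w₁} → ⟦ L ⟧ w w₁ → Split L w w₁
  split L@(word , _ , _)  t            = split-one L refl t
  split L@(left , _ , _)  (one n t)    = split-one L n t
  split (left , _ , _)    (more n l t) with left-bottom l
  ... | _ , _ , m , _ , n₁ , t₁ , p , s = ends _ m _ (inj₂ (_ , _ , n₁ , p , n)) t₁ s t
  split L@(right , _ , _) (one n t)    = split-one L n t
  split (right , _ , _)   (more n t r) with right-bottom r
  ... | _ , _ , m , _ , n₁ , t₁ , p , s = ends _ m _ (inj₂ (_ , _ , n , p , n₁)) t s t₁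

  mutual
    -- The spines regroup subtrees into sequences that are not subterms. The induction is therefore
    -- on a bound for the remaining input, which drops with the opening symbol.
    complete : ∀ n L {w w₁} → length w ≤ n → ⟦ L ⟧ w w₁ → Gen L w w₁
    complete n L w≤n s with split L s
    ... | leaf Z a o l refl = single (Z , o , l)
    ... | ends C m D e t s₁ t₁ with left-spine t | right-spine t₁
    complete (suc n) L (s≤s w≤n) s | ends C m D e t s₁ t₁
      | A , a , mₗ , _ , refl , p , l , s₂ | B , b , mᵣ , q , l₁ , s₃ =
      rule (L , m , (a , C , A , mₗ) , (b , D , B , mᵣ)) (e , (p , l) , (q , l₁))
        (complete? n (mₗ ∷ m ∷ mᵣ ∷ []) w≤n (_ , s₂ , _ , s₁ , _ , s₃ , refl))

    complete? : ∀ n ms {w w₁} → length w ≤ n → Sequence ms w w₁ → Gens (catMaybes ms) w w₁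
    complete? n []             w≤n refl        = []
    complete? n (nothing ∷ ms) w≤n (_ , refl , ss) = complete? n ms w≤n ss
    complete? n (just L ∷ ms)  w≤n (_ , s , ss) =
      complete n L w≤n s ∷ complete? n ms (≤-trans (maybe-length (just L) s) w≤n) ss

  gen⇔tree : ∀ {w} → Gen (word , start , start) w [] ⇔ Tree start w []
  gen⇔tree = mk⇔ sound (complete _ _ ≤-refl)

-- From context-free grammars to Chomsky normal form

module Closure {A : Set} (_≟_ : DecidableEquality A) (clauses : List (List A × A)) where

  open DecMembership _≟_ using (_∈?_)

  data Derivable : A → Set where
    derive : ∀ {premises a} → (premises , a) ∈ˡ clauses → All Derivable premises → Derivable a

  -- The recursion is on the number of clauses that have not been applied.
  saturate : ∀ n known pending → length pending ≤ n → All Derivable known →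
             (∀ {c} → c ∈ˡ clauses → c ∈ˡ pending ⊎ proj₂ c ∈ˡ known) → (∀ {c} → c ∈ˡ pending → c ∈ˡ clauses) →
             ∃[ known′ ] (All Derivable known′ ×
               (∀ {premises a} → (premises , a) ∈ˡ clauses → All (_∈ˡ known′) premises → a ∈ˡ known′))
  saturate n known pending len derivable applied pending⊆ with Any.any? (λ c → All.all? (_∈? known) (proj₁ c)) pending
  ... | no none = known , derivable , closed
    where
    closed : ∀ {premises a} → (premises , a) ∈ˡ clauses → All (_∈ˡ known) premises → a ∈ˡ known
    closed c∈ ps with applied c∈
    ... | inj₁ c∈p = ⊥-elim (none (Any.map (λ { refl → ps }) c∈p))
    ... | inj₂ a∈  = a∈
  ... | yes some with find some
  ... | (premises , a) , c∈ , ps with ∈-∃++ c∈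
  saturate zero known .(cs ++ (premises , a) ∷ cs′) len derivable applied pending⊆
    | yes some | (premises , a) , c∈ , ps | cs , cs′ , refl
    with () ← ≤-trans (≤-reflexive (trans (sym (+-suc (length cs) _)) (sym (List.length-++ cs)))) len
  saturate (suc n) known .(cs ++ (premises , a) ∷ cs′) len derivable applied pending⊆
    | yes some | (premises , a) , c∈ , ps | cs , cs′ , refl =
    saturate n (a ∷ known) (cs ++ cs′) shorter
      (derive (pending⊆ c∈) (All.map (All.lookup derivable) ps) ∷ derivable)
      applied′ (λ c∈′ → pending⊆ (weaken (∈-++⁻ cs c∈′)))
    where
    weaken : ∀ {c} → c ∈ˡ cs ⊎ c ∈ˡ cs′ → c ∈ˡ cs ++ (premises , a) ∷ cs′
    weaken (inj₁ c∈′) = ∈-++⁺ˡ c∈′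
    weaken (inj₂ c∈′) = ∈-++⁺ʳ cs (there c∈′)
    shorter : length (cs ++ cs′) ≤ n
    shorter with ≤-trans (≤-reflexive (sym length≡)) len
      where
      length≡ : length (cs ++ (premises , a) ∷ cs′) ≡ suc (length (cs ++ cs′))
      length≡ = trans (List.length-++ cs) (trans (+-suc (length cs) _) (cong suc (sym (List.length-++ cs))))
    ... | s≤s le = le
    applied′ : ∀ {c} → c ∈ˡ clauses → c ∈ˡ cs ++ cs′ ⊎ proj₂ c ∈ˡ a ∷ known
    applied′ c∈′ with applied c∈′
    ... | inj₂ k∈ = inj₂ (there k∈)
    ... | inj₁ p∈ with ∈-++⁻ cs p∈
    ...   | inj₁ q            = inj₁ (∈-++⁺ˡ q)
    ...   | inj₂ (here refl)  = inj₂ (here refl)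
    ...   | inj₂ (there q)    = inj₁ (∈-++⁺ʳ cs q)

  derivable? : ∀ a → Dec (Derivable a)
  derivable? a with saturate (length clauses) [] clauses ≤-refl [] inj₁ id
  ... | known , sound , closed = map′ (All.lookup sound) member (a ∈? known)
    where
    mutual
      member : ∀ {a} → Derivable a → a ∈ˡ known
      member (derive c∈ ds) = closed c∈ (members ds)

      members : ∀ {as} → All Derivable as → All (_∈ˡ known) as
      members []       = []
      members (d ∷ ds) = member d ∷ members ds

-- Reachability of `j` is a closure: `j` is an axiom, and each edge is a clause leading from its end
-- to its beginning.
star? : ∀ {n} {R : Fin n → Fin n → Set} → (∀ i j → Dec (R i j)) → ∀ i j → Dec (Star R i j)
star? {n} {R} R? i j = map′ to from (derivable? i)
  where
  edges : List (Fin n × Fin n)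
  edges = filter (uncurry R?) (cartesianProduct (elements (finite-Fin n)) (elements (finite-Fin n)))
  edge : Fin n × Fin n → List (Fin n) × Fin n
  edge (k , l) = [ l ] , k
  open Closure _≟ᶠ_ (([] , j) ∷ map edge edges)
  to : ∀ {k} → Derivable k → Star R k j
  to (derive (here refl) []) = ε
  to (derive (there c∈) ds) with ∈-map⁻ edge c∈
  to (derive (there c∈) (d ∷ [])) | e , e∈ , refl =
    proj₂ (∈-filter⁻ (uncurry R?) {xs = cartesianProduct (elements (finite-Fin n)) (elements (finite-Fin n))} e∈) ◅ to d
  from : ∀ {k} → Star R k j → Derivable k
  from ε = derive (here refl) []
  from (r ◅ rs) = derive (there (∈-map⁺ edge (∈-filter⁺ (uncurry R?)
    (∈-cartesianProduct⁺ (∈-elements (finite-Fin n) _) (∈-elements (finite-Fin n) _)) r))) (from rs ∷ [])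

suffixes : {A : Set} → List A → List (List A)
suffixes []       = [] ∷ []
suffixes (x ∷ xs) = (x ∷ xs) ∷ suffixes xs

∈-suffixes : {A : Set} (xs : List A) → xs ∈ˡ suffixes xs
∈-suffixes []       = here refl
∈-suffixes (x ∷ xs) = here refl

suffixes-tail : {A : Set} {y : A} {ys : List A} (xs : List A) → y ∷ ys ∈ˡ suffixes xs → ys ∈ˡ suffixes xs
suffixes-tail []       (here ())
suffixes-tail (x ∷ xs) (here refl) = there (∈-suffixes xs)
suffixes-tail (x ∷ xs) (there ys∈) = there (suffixes-tail xs ys∈)

-- Elimination of empty and unit rules

module Normalisation {Σ : Set} (Σ-finite : Finite Σ) (G : ContextFreeGrammar Σ) where

  open ContextFreeGrammar G using (N; N-finite; rules; _⇒_; rewrite-with; language) renaming (start to start₀)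

  Symbol : Set
  Symbol = N ⊎ Σ

  _≟ₛ_ : DecidableEquality Symbol
  _≟ₛ_ = Sum.≡-dec (≟-finite N-finite) (≟-finite Σ-finite)

  _≟ₗ_ : DecidableEquality (List Symbol)
  _≟ₗ_ = List.≡-dec _≟ₛ_

  open DecMembership (Product.≡-dec (≟-finite N-finite) _≟ₗ_) using () renaming (_∈?_ to _∈rules?_)

  data Yields : List Symbol → List Σ → List Σ → Set where
    []   : ∀ {w} → Yields [] w w
    read : ∀ {a β w w₁} → Yields β w w₁ → Yields (inj₂ a ∷ β) (a ∷ w) w₁
    call : ∀ {X α β w w₁ w₂} → (X , α) ∈ˡ rules → Yields α w w₁ → Yields β w₁ w₂ → Yields (inj₁ X ∷ β) w w₂

  yields-++ : ∀ {β w w₁ w₂} α → Yields α w w₁ → Yields β w₁ w₂ → Yields (α ++ β) w w₂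
  yields-++ []           []             y₁ = y₁
  yields-++ (inj₂ a ∷ α) (read y)       y₁ = read (yields-++ α y y₁)
  yields-++ (inj₁ X ∷ α) (call r∈ y y′) y₁ = call r∈ y (yields-++ α y′ y₁)

  yields-split : ∀ {β w w₂} α → Yields (α ++ β) w w₂ → ∃[ w₁ ] (Yields α w w₁ × Yields β w₁ w₂)
  yields-split []           y = _ , [] , y
  yields-split (inj₂ a ∷ α) (read y) with yields-split α y
  ... | _ , y₁ , y₂ = _ , read y₁ , y₂
  yields-split (inj₁ X ∷ α) (call r∈ y y′) with yields-split α y′
  ... | _ , y₁ , y₂ = _ , call r∈ y y₁ , y₂

  yields-word : ∀ w → Yields (map inj₂ w) w []
  yields-word []      = []
  yields-word (a ∷ w) = read (yields-word w)

  yields-⇐ : ∀ {γ δ w w₁} → γ ⇒ δ → Yields δ w w₁ → Yields γ w w₁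
  yields-⇐ (rewrite-with {α = α} r∈ η θ) y with yields-split η y
  ... | _ , y₁ , y₂ with yields-split α y₂
  ... | _ , y₃ , y₄ = yields-++ η y₁ (call r∈ y₃ y₄)

  yields-⇐* : ∀ {γ δ w w₁} → Star _⇒_ γ δ → Yields δ w w₁ → Yields γ w w₁
  yields-⇐* ε        y = y
  yields-⇐* (r ◅ rs) y = yields-⇐ r (yields-⇐* rs y)

  ⇒-context : ∀ η θ {γ δ} → γ ⇒ δ → η ++ γ ++ θ ⇒ η ++ δ ++ θ
  ⇒-context η θ (rewrite-with {X} {α} r∈ η′ θ′) =
    subst₂ _⇒_ (eq (inj₁ X ∷ θ′))
      (trans (cong ((η ++ η′) ++_) (sym (List.++-assoc α θ′ θ))) (eq (α ++ θ′)))
      (rewrite-with r∈ (η ++ η′) (θ′ ++ θ))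
    where
    eq : ∀ ζ → (η ++ η′) ++ ζ ++ θ ≡ η ++ (η′ ++ ζ) ++ θ
    eq ζ = trans (List.++-assoc η η′ (ζ ++ θ)) (cong (η ++_) (sym (List.++-assoc η′ ζ θ)))

  ⇒*-++ : ∀ {γ γ′ δ δ′} → Star _⇒_ γ γ′ → Star _⇒_ δ δ′ → Star _⇒_ (γ ++ δ) (γ′ ++ δ′)
  ⇒*-++ {γ} {γ′} {δ} {δ′} r r′ =
    gmap (_++ δ) (⇒-context [] δ) r ◅◅
    gmap (γ′ ++_) (λ {ζ} {ζ′} st → subst₂ _⇒_ (cong (γ′ ++_) (List.++-identityʳ ζ)) (cong (γ′ ++_) (List.++-identityʳ ζ′))
      (⇒-context γ′ [] st)) r′

  yields-⇒* : ∀ {γ w w₁} → Yields γ w w₁ → ∃[ u ] (w ≡ u ++ w₁ × Star _⇒_ γ (map inj₂ u))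
  yields-⇒* [] = [] , refl , ε
  yields-⇒* (read {a = a} y) with yields-⇒* y
  ... | u , refl , r = a ∷ u , refl , ⇒*-++ {γ = [ inj₂ a ]} ε r
  yields-⇒* (call {X} {α} {β} {w₂ = w₂} r∈ y y₁) with yields-⇒* y | yields-⇒* y₁
  ... | u , refl , r | v , refl , r₁ = u ++ v , sym (List.++-assoc u v w₂) ,
    rewrite-with r∈ [] β ◅ subst (Star _⇒_ (α ++ β)) (sym (List.map-++ inj₂ u v)) (⇒*-++ r r₁)

  language⇒yields : ∀ {w} → language w → Yields [ inj₁ start₀ ] w []
  language⇒yields {w} r = yields-⇐* r (yields-word w)

  yields⇒language : ∀ {w} → Yields [ inj₁ start₀ ] w [] → language w
  yields⇒language y with yields-⇒* y
  ... | u , refl , r = subst (λ v → Star _⇒_ [ inj₁ start₀ ] (map inj₂ v)) (sym (List.++-identityʳ u)) r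

  production : N × List Symbol → List Symbol × Symbol
  production (X , α) = α , inj₁ X

  open Closure _≟ₛ_ (map production rules) using (derive; derivable?) renaming (Derivable to Nullable)

  nullable : ∀ {X α} → (X , α) ∈ˡ rules → All Nullable α → Nullable (inj₁ X)
  nullable r∈ ns = derive (∈-map⁺ production r∈) ns

  mutual
    nullable-yields : ∀ {s β w w₁} → Nullable s → Yields β w w₁ → Yields (s ∷ β) w w₁
    nullable-yields (derive c∈ ns) y with ∈-map⁻ production c∈
    ... | _ , r∈ , refl = call r∈ (null-yields ns) y

    null-yields : ∀ {γ w} → All Nullable γ → Yields γ w w
    null-yields []       = []
    null-yields (n ∷ ns) = nullable-yields n (null-yields ns)

  data Extent (γ : List Symbol) (w w₁ : List Σ) : Set where
    null     : w ≡ w₁ → All Nullable γ → Extent γ w w₁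
    nonempty : length w₁ < length w → Extent γ w w₁

  extent : ∀ {γ w w₁} → Yields γ w w₁ → Extent γ w w₁
  extent [] = null refl []
  extent (read y) with extent y
  ... | null refl _ = nonempty (n<1+n _)
  ... | nonempty lt = nonempty (m<n⇒m<1+n lt)
  extent (call r∈ y y₁) with extent y | extent y₁
  ... | null refl ns | null refl ns₁ = null refl (nullable r∈ ns ∷ ns₁)
  ... | null refl _  | nonempty lt   = nonempty lt
  ... | nonempty lt  | null refl _   = nonempty lt
  ... | nonempty lt  | nonempty lt₁  = nonempty (<-trans lt₁ lt)

  -- These moves read nothing and discard only nullable symbols. `Leaf` and `Node` of the new
  -- grammar absorb chains of them, which is how empty and unit rules disappear.
  data Step : List Symbol → List Symbol → Set where
    drop   : ∀ {s β} → Nullable s → Step (s ∷ β) β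
    expand : ∀ {X α β} → (X , α) ∈ˡ rules → All Nullable β → Step (inj₁ X ∷ β) α

  data IsLeaf : List Symbol → Σ → Set where
    leaf : ∀ {a β} → All Nullable β → IsLeaf (inj₂ a ∷ β) a

  data IsNode : List Symbol → List Symbol → List Symbol → Set where
    read : ∀ {a β} → IsNode (inj₂ a ∷ β) [ inj₂ a ] β
    call : ∀ {X α β} → (X , α) ∈ˡ rules → IsNode (inj₁ X ∷ β) α β

  step? : ∀ γ δ → Dec (Step γ δ)
  step? []           δ = no λ ()
  step? (inj₂ a ∷ β) δ = map′ (λ { (refl , n) → drop n }) (λ { (drop n) → refl , n })
    ((β ≟ₗ δ) ×-dec derivable? (inj₂ a))
  step? (inj₁ X ∷ β) δ = map′
    (λ { (inj₁ (refl , n)) → drop n ; (inj₂ (r∈ , ns)) → expand r∈ ns })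
    (λ { (drop n) → inj₁ (refl , n) ; (expand r∈ ns) → inj₂ (r∈ , ns) })
    (((β ≟ₗ δ) ×-dec derivable? (inj₁ X)) ⊎-dec (((X , δ) ∈rules? rules) ×-dec All.all? derivable? β))

  isLeaf? : ∀ γ a → Dec (IsLeaf γ a)
  isLeaf? []           a = no λ ()
  isLeaf? (inj₁ X ∷ β) a = no λ ()
  isLeaf? (inj₂ b ∷ β) a = map′ (λ { (refl , ns) → leaf ns }) (λ { (leaf ns) → refl , ns })
    ((≟-finite Σ-finite b a) ×-dec All.all? derivable? β)

  isNode? : ∀ γ α β → Dec (IsNode γ α β)
  isNode? []           α β = no λ ()
  isNode? (inj₂ a ∷ γ) α β = map′ (λ { (refl , refl) → read }) (λ { read → refl , refl })
    (([ inj₂ a ] ≟ₗ α) ×-dec (γ ≟ₗ β))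
  isNode? (inj₁ X ∷ γ) α β = map′ (λ { (r∈ , refl) → call r∈ }) (λ { (call r∈) → r∈ , refl })
    (((X , α) ∈rules? rules) ×-dec (γ ≟ₗ β))

  -- The new nonterminals are suffixes of these strings. The single letters are there for the left
  -- children of the nodes given by `read`.
  sides : List (List Symbol)
  sides = [ inj₁ start₀ ] ∷ map (λ a → [ inj₂ a ]) (elements Σ-finite) ++ map proj₂ rules

  items : List (List Symbol)
  items = concatMap suffixes sides

  Item : Set
  Item = Fin (length items)

  ⟦_⟧ : Item → List Symbol
  ⟦_⟧ = lookup items

  item : ∀ {γ} → γ ∈ˡ items → ∃[ i ] ⟦ i ⟧ ≡ γ
  item γ∈ = Any.index γ∈ , sym (lookup-index γ∈)

  side-item : ∀ {γ} → γ ∈ˡ sides → γ ∈ˡ items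
  side-item {γ} γ∈ = ∈-concatMap⁺ suffixes (Any.map (λ { refl → ∈-suffixes γ }) γ∈)

  tail-item : ∀ {s γ} → s ∷ γ ∈ˡ items → γ ∈ˡ items
  tail-item γ∈ = ∈-concatMap⁺ suffixes (Any.map (λ {xs} → suffixes-tail xs) (∈-concatMap⁻ suffixes {xs = sides} γ∈))

  letter-item : ∀ a → [ inj₂ a ] ∈ˡ items
  letter-item a = side-item (there (∈-++⁺ˡ (∈-map⁺ (λ b → [ inj₂ b ]) (∈-elements Σ-finite a))))

  rule-item : ∀ {X α} → (X , α) ∈ˡ rules → α ∈ˡ items
  rule-item r∈ = side-item (there (∈-++⁺ʳ (map (λ a → [ inj₂ a ]) (elements Σ-finite)) (∈-map⁺ proj₂ r∈)))

  start-item : ∃[ i ] ⟦ i ⟧ ≡ [ inj₁ start₀ ]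
  start-item = item (side-item (here refl))

  Steps : Item → Item → Set
  Steps = Star (λ i j → Step ⟦ i ⟧ ⟦ j ⟧)

  steps? : ∀ i j → Dec (Steps i j)
  steps? = star? (λ i j → step? ⟦ i ⟧ ⟦ j ⟧)

  chomsky : Chomsky Σ
  chomsky = record
    { size  = length items
    ; Leaf  = λ i a → ∃[ j ] (Steps i j × IsLeaf ⟦ j ⟧ a)
    ; Node  = λ i k l → ∃[ j ] (Steps i j × IsNode ⟦ j ⟧ ⟦ k ⟧ ⟦ l ⟧)
    ; leaf? = λ i a → any? λ j → steps? i j ×-dec isLeaf? ⟦ j ⟧ a
    ; node? = λ i k l → any? λ j → steps? i j ×-dec isNode? ⟦ j ⟧ ⟦ k ⟧ ⟦ l ⟧
    ; start = proj₁ start-item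
    }

  open Chomsky chomsky using (Tree; leaf; node)

  step-yields : ∀ {γ δ w w₁} → Step γ δ → Yields δ w w₁ → Yields γ w w₁
  step-yields (drop n)      y = nullable-yields n y
  step-yields (expand r∈ ns) y = call r∈ y (null-yields ns)

  steps-yields : ∀ {i j w w₁} → Steps i j → Yields ⟦ j ⟧ w w₁ → Yields ⟦ i ⟧ w w₁
  steps-yields ε        y = y
  steps-yields (s ◅ ss) y = step-yields s (steps-yields ss y)

  leaf-yields : ∀ {γ a w} → IsLeaf γ a → Yields γ (a ∷ w) w
  leaf-yields (leaf ns) = read (null-yields ns)

  node-yields : ∀ {γ α β w w₁ w₂} → IsNode γ α β → Yields α w w₁ → Yields β w₁ w₂ → Yields γ w w₂
  node-yields read      (read []) y₁ = read y₁
  node-yields (call r∈) y         y₁ = call r∈ y y₁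

  tree-yields : ∀ {i w w₁} → Tree i w w₁ → Yields ⟦ i ⟧ w w₁
  tree-yields (leaf (_ , ss , l))      = steps-yields ss (leaf-yields l)
  tree-yields (node (_ , ss , n) t t₁) = steps-yields ss (node-yields n (tree-yields t) (tree-yields t₁))

  step-tree : ∀ {i j w w₁} → Step ⟦ i ⟧ ⟦ j ⟧ → Tree j w w₁ → Tree i w w₁
  step-tree s (leaf (j , ss , l))      = leaf (j , s ◅ ss , l)
  step-tree s (node (j , ss , n) t t₁) = node (j , s ◅ ss , n) t t₁

  -- If one of the two parts of a derivation is empty, it is nullable, and the other part alone
  -- gives the tree; otherwise there is a node. The index is arbitrary, because a suffix may occur
  -- among `items` several times.
  yields-tree : ∀ {γ w w₁} → Yields γ w w₁ → length w₁ < length w → γ ∈ˡ items → ∀ i → ⟦ i ⟧ ≡ γ → Tree i w w₁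
  yields-tree [] lt _ _ _ = ⊥-elim (<-irrefl refl lt)
  yields-tree (read {a} y) _ γ∈ i eq with extent y | item (letter-item a) | item (tail-item γ∈)
  ... | null refl ns | _       | _       = leaf (i , ε , subst (λ γ → IsLeaf γ a) (sym eq) (leaf ns))
  ... | nonempty lt  | k , eq₁ | l , eq₂ =
    node (i , ε , subst₂ (IsNode ⟦ i ⟧) (sym eq₁) (sym eq₂) (subst (λ γ → IsNode γ _ _) (sym eq) read))
      (leaf (k , ε , subst (λ γ → IsLeaf γ a) (sym eq₁) (leaf [])))
      (yields-tree y lt (tail-item γ∈) l eq₂)
  yields-tree (call r∈ y y₁) lt γ∈ i eq with extent y | extent y₁ | item (rule-item r∈) | item (tail-item γ∈)
  ... | null refl _  | null refl _   | _ | _ = ⊥-elim (<-irrefl refl lt)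
  ... | null refl ns | nonempty lt₁  | _ | l , eq₂ =
    step-tree (subst₂ Step (sym eq) (sym eq₂) (drop (nullable r∈ ns))) (yields-tree y₁ lt₁ (tail-item γ∈) l eq₂)
  ... | nonempty lt₁ | null refl ns  | k , eq₁ | _ =
    step-tree (subst₂ Step (sym eq) (sym eq₁) (expand r∈ ns)) (yields-tree y lt₁ (rule-item r∈) k eq₁)
  ... | nonempty lt₁ | nonempty lt₂  | k , eq₁ | l , eq₂ =
    node (i , ε , subst₂ (IsNode ⟦ i ⟧) (sym eq₁) (sym eq₂) (subst (λ γ → IsNode γ _ _) (sym eq) (call r∈)))
      (yields-tree y lt₁ (rule-item r∈) k eq₁) (yields-tree y₁ lt₂ (tail-item γ∈) l eq₂)

  tree⇔language : ∀ w → w ≢ [] → Tree (proj₁ start-item) w [] ⇔ language w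
  tree⇔language []      w≢[] = ⊥-elim (w≢[] refl)
  tree⇔language (a ∷ w) _    = mk⇔
    (λ t → yields⇒language (subst (λ γ → Yields γ (a ∷ w) []) (proj₂ start-item) (tree-yields t)))
    (λ r → yields-tree (language⇒yields r) (s≤s z≤n) (side-item (here refl)) _ (proj₂ start-item))

-- Context-free languages as inverse homomorphic images of one language

corollary1 : ∃[ Ω ] Finite Ω × (Σ[ L₀ ∈ Language Ω ]
    (Σ[ G ∈ CategorialGrammar Ω ]
    CategorialGrammar.UniqueCategoryAssignment G
    × L₀ ≐ CategorialGrammar.language G)
    × ((Σ : Set) → Finite Σ →
    (L : Language Σ) → L ⊆ NonEmpty → ContextFree L →
    Σ[ h ∈ (Σ → List⁺ Ω) ]
    (∀ w → w ∈ NonEmpty {Σ} →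
    (w ∈ L ⇔ homomorphism h w ∈ L₀))))
corollary1 = Letter , finite-Letter , CategorialGrammar.language grammar ,
  (grammar , unique-assignment , id , id) , λ Σ Σ-finite L _ (G , L⊆ , ⊆L) →
    let open Normalisation Σ-finite G using (chomsky; tree⇔language)
        open Spines Σ-finite chomsky using (double-greibach; gen⇔tree)
        open Coding (≟-finite Σ-finite) double-greibach using (hom; recognised)
    in hom , λ w w≢[] →
         recognised w w≢[] ⇔-∘ (⇔-sym gen⇔tree ⇔-∘ (⇔-sym (tree⇔language w w≢[]) ⇔-∘ mk⇔ L⊆ ⊆L))
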